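{- Let $G=(V,E)$ be a directed graph with $n$ vertices and $\mathbb{F}$ a finite field. For all $u,v\in V$ let $x_{u,v}\in\mathbb{F}$ be a uniformly random element, and for all $v\in V$ let $y_v\in\mathbb{F}$ be a uniformly random element, all sampled independently. Let $A\in\mathbb{F}^{n\times n}$ be defined by $A_{u,v}=x_{u,v}\cdot y_v$ if $u=v$ or $uv\in E$, and $A_{u,v}=0$ otherwise. Then, with probability at least $1-n^4/|\mathbb{F}|$: (1) $A$ is generic; and (2) for every $u,v\in V$ and $k\in [n-1]$, $(A^k)_{u,v}\neq 0$ if and only if there exists a path $u\to v$ in $G$ of length at most $k$.
   Context: A matrix is generic if its characteristic polynomial equals its minimal polynomial. $V$ is identified with $[n]=\{1,\ldots,n\}$ to index rows/columns; the length of a path is its number of edges. -}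

module Defs where

open import Level using (Level; _⊔_) renaming (suc to lsuc)
open import Algebra.Bundles using (CommutativeRing)
open import Data.Nat as ℕ using (ℕ; zero; suc; _≤_; _∸_)
open import Data.Fin using (Fin; zero; suc; punchIn; fromℕ; inject₁; _≟_)
open import Data.Bool using (Bool; true; false; if_then_else_; _∨_)
open import Data.List using (List; []; _∷_; map; length)
open import Data.List.Relation.Unary.All using (All)
open import Data.List.Relation.Unary.Unique.Propositional using (Unique)
open import Data.Vec using (Vec; lookup)
open import Data.Product using (Σ; ∃; _×_; _,_)
open import Relation.Nullary using (¬_; does)
open import Relation.Binary.PropositionalEquality using (_≡_)
open import Function.Definitions using (Injective)

record FiniteField (c ℓ : Level) : Set (lsuc (c ⊔ ℓ)) where
  field
    commRing : CommutativeRing c ℓ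
  open CommutativeRing commRing public hiding (ring)
  field
    0≉1       : ¬ (0# ≈ 1#)
    inverse   : ∀ x → ¬ (x ≈ 0#) → ∃ λ y → x * y ≈ 1#
    size      : ℕ
    enum      : Fin size → Carrier
    enum-surj : ∀ x → ∃ λ i → enum i ≈ x
    enum-inj  : ∀ i j → enum i ≈ enum j → i ≡ j

Digraph : ℕ → Set
Digraph n = Fin n → Fin n → Bool

record Path {n : ℕ} (E : Digraph n) (u v : Fin n) (l : ℕ) : Set where
  field
    vert  : Fin (suc l) → Fin n
    start : vert zero ≡ u
    end   : vert (fromℕ l) ≡ v
    edges : ∀ (i : Fin l) → E (vert (inject₁ i)) (vert (suc i)) ≡ true
    distinct : Injective _≡_ _≡_ vert

PathWithin : {n : ℕ} → Digraph n → Fin n → Fin n → ℕ → Set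
PathWithin E u v k = Σ ℕ λ l → l ≤ k × Path E u v l

module _ {c ℓ : Level} (𝔽 : FiniteField c ℓ) where
  open FiniteField 𝔽 using (Carrier; _≈_; _+_; _*_; -_; 0#; 1#; size; enum)

  Mat : ℕ → Set c
  Mat n = Fin n → Fin n → Carrier

  ∑ : ∀ {n} → (Fin n → Carrier) → Carrier
  ∑ {zero}  f = 0#
  ∑ {suc n} f = f zero + ∑ (λ i → f (suc i))

  _⊗_ : ∀ {n} → Mat n → Mat n → Mat n
  (A ⊗ B) i j = ∑ (λ k → A i k * B k j)

  idM : ∀ {n} → Mat n
  idM i j = if does (i ≟ j) then 1# else 0#

  zeroM : ∀ {n} → Mat n
  zeroM i j = 0#

  _^M_ : ∀ {n} → Mat n → ℕ → Mat n
  A ^M zero  = idM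
  A ^M suc k = A ⊗ (A ^M k)

  -- Polynomials over 𝔽: coefficient lists, lowest degree first.
  Poly : Set c
  Poly = List Carrier

  coeff : Poly → ℕ → Carrier
  coeff []      _       = 0#
  coeff (a ∷ p) zero    = a
  coeff (a ∷ p) (suc i) = coeff p i

  _+P_ : Poly → Poly → Poly
  []      +P q       = q
  (a ∷ p) +P []      = a ∷ p
  (a ∷ p) +P (b ∷ q) = (a + b) ∷ (p +P q)

  _*P_ : Poly → Poly → Poly
  []      *P q = []
  (a ∷ p) *P q = map (a *_) q +P (0# ∷ (p *P q))

  -P_ : Poly → Poly
  -P p = map (-_) p

  constP : Carrier → Poly
  constP a = a ∷ []

  varX : Poly
  varX = 0# ∷ 1# ∷ []

  altSum : ∀ {n} → (Fin n → Poly) → Poly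
  altSum {zero}  f = []
  altSum {suc n} f = f zero +P (-P altSum (λ i → f (suc i)))

  detP : ∀ n → (Fin n → Fin n → Poly) → Poly
  detP zero    M = constP 1#
  detP (suc n) M = altSum (λ j → M zero j *P detP n (λ r s → M (suc r) (punchIn j s)))

  charPoly : ∀ {n} → Mat n → Poly
  charPoly {n} A = detP n (λ i j →
    if does (i ≟ j) then varX +P (-P constP (A i j)) else -P constP (A i j))

  evalP : ∀ {n} → Poly → Mat n → Mat n
  evalP []      A = zeroM
  evalP (a ∷ p) A i j = a * idM i j + (A ⊗ evalP p A) i j

  MonicOfDegree : Poly → ℕ → Set ℓ
  MonicOfDegree p d = (coeff p d ≈ 1#) × (∀ i → d ℕ.< i → coeff p i ≈ 0#)

  Annihilates : ∀ {n} → Poly → Mat n → Set ℓ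
  Annihilates p A = ∀ i j → evalP p A i j ≈ 0#

  IsMinimalPolynomial : ∀ {n} → Mat n → Poly → Set (c ⊔ ℓ)
  IsMinimalPolynomial A p =
    Σ ℕ λ d → MonicOfDegree p d × Annihilates p A ×
      (∀ q e → MonicOfDegree q e → Annihilates q A → d ≤ e)

  Generic : ∀ {n} → Mat n → Set (c ⊔ ℓ)
  Generic A = IsMinimalPolynomial A (charPoly A)

  weightedMatrix : ∀ {n} → Digraph n → Mat n → (Fin n → Carrier) → Mat n
  weightedMatrix E x y u v =
    if does (u ≟ v) ∨ E u v then x u v * y v else 0#

  GoodMatrix : ∀ {n} → Digraph n → Mat n → Set (c ⊔ ℓ)
  GoodMatrix {n} E A =
    Generic A ×
    (∀ (u v : Fin n) (k : ℕ) → 1 ≤ k → k ≤ n ∸ 1 →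
      ((¬ ((A ^M k) u v ≈ 0#) → PathWithin E u v k) ×
       (PathWithin E u v k → ¬ ((A ^M k) u v ≈ 0#))))

  -- a sample point (x, y), encoded by indices into the enumeration of 𝔽;
  -- the uniform product measure is the counting measure on samples
  Sample : ℕ → Set
  Sample n = Vec (Vec (Fin size) n) n × Vec (Fin size) n

  matrixOf : ∀ {n} → Digraph n → Sample n → Mat n
  matrixOf E (xs , ys) =
    weightedMatrix E (λ u v → enum (lookup (lookup xs u) v)) (λ v → enum (lookup ys v))

  -- "Pr[good] ≥ 1 − n⁴/|𝔽|": there are at least (1 − n⁴/q)·q^N distinct good
  -- samples, N = n² + n, written without division:
  -- (#good)·q + n⁴·q^N ≥ q^(N+1).
  ProbabilityAtLeast1-n⁴/q : ∀ {n} → (Sample n → Set (c ⊔ ℓ)) → Set (c ⊔ ℓ)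
  ProbabilityAtLeast1-n⁴/q {n} P =
    Σ (List (Sample n)) λ good → Unique good × All P good ×
      (size ℕ.^ (n ℕ.* n ℕ.+ n ℕ.+ 1)
        ≤ length good ℕ.* size ℕ.+ (n ℕ.^ 4) ℕ.* size ℕ.^ (n ℕ.* n ℕ.+ n))

{-# OPTIONS --safe #-}

-- Each requirement on A is the non-vanishing of a test G(A) whose degree along
-- any line in the (x , y)-space is bounded. For the entry (Aᵏ)ᵤᵥ the degree is
-- 2k; a path u → v of length ≤ k gives a 0/1 sample with (Aᵏ)ᵤᵥ = 1. For
-- genericity the test is the determinant of the vectors (A - c₀) ⋯ (A - cₖ₋₁) 1
-- for k < n with distinct constants cᵢ, of degree n(n-1): if it is non-zero, no
-- polynomial of degree < n annihilates A, so the characteristic polynomial is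
-- minimal by Cayley–Hamilton, and it is non-zero at a diagonal matrix with
-- entries cᵢ. A test of degree d that is non-zero at some sample p vanishes with
-- probability at most d / (q - 1), by counting roots on the lines through p. The
-- degrees add up to n(n-1)(n² + 1) < n⁴ (for n ≥ 1), which absorbs q - 1 in place of q.

module Submission where

open import Defs
open import Level using (Level; _⊔_)
open import Algebra.Bundles using (CommutativeRing; Ring)
open import Algebra.Bundles.Raw using (RawRing)
open import Algebra.Morphism.Structures using (module RingMorphisms)
open import Data.Bool using (Bool; true; false; if_then_else_; _∨_)
open import Data.Fin as Fin using (Fin; zero; suc; punchIn; punchOut; _≟_; toℕ; fromℕ; fromℕ<; inject₁; opposite)
open import Data.Fin.Properties
  using (punchIn-punchOut; punchInᵢ≢i; toℕ<n; toℕ-fromℕ; toℕ-fromℕ<; toℕ-inject₁; fromℕ<-injective; inject₁-injective;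
         fromℕ≢inject₁; opposite-involutive; opposite-prop; suc-injective)
open import Data.Fin.Relation.Unary.Top using (view; ‵fromℕ; ‵inject₁)
open import Data.List using (List; []; _∷_; length; map; _++_; tabulate; allFin; filter; cartesianProductWith; cartesianProduct)
open import Data.List.Membership.Propositional using (_∈_; lose; find)
open import Data.List.Membership.Propositional.Properties using (∈-cartesianProductWith⁺; ∈-cartesianProduct⁺; ∈-allFin)
open import Data.List.Relation.Unary.All as All using (All; []; _∷_)
open import Data.List.Relation.Unary.All.Properties using (all-filter)
open import Data.List.Relation.Unary.AllPairs using ([]; _∷_)
open import Data.List.Relation.Unary.Any using (here; any?)
open import Data.List.Relation.Unary.Unique.Propositional using (Unique)
open import Data.Nat as ℕ using (ℕ; zero; suc; z≤n; s≤s; _∸_)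
open import Data.Nat.Tactic.RingSolver using (solve-∀)
open import Data.Product using (_×_; _,_; proj₁; proj₂; Σ; ∃)
open import Data.Sum using (_⊎_; inj₁; inj₂)
open import Data.Unit.Polymorphic using (⊤; tt)
open import Data.Vec as Vec using (Vec; []; _∷_; lookup; zipWith)
open import Data.Vec.Functional using (removeAt) renaming (_∷_ to _∷ᶠ_)
open import Function using (_∘_; id)
open import Relation.Binary.PropositionalEquality as ≡ using (_≡_; _≢_; module ≡-Reasoning)
open import Relation.Nullary using (¬_; Dec; does; yes; no; contradiction)
open import Relation.Nullary.Decidable using (map′; dec-true; ¬?)
open import Relation.Unary using (Decidable)
import Algebra.Construct.Pointwise as Pointwise
import Algebra.Morphism.RingMonomorphism as RingMonomorphism
import Algebra.Properties.CommutativeMonoid.Sum as MonoidSum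
import Algebra.Properties.Semiring.Sum as SemiringSum
import Data.Bool.Properties as Bool
import Data.Fin.Permutation as Perm
import Data.Fin.Properties as Fin
import Data.List.Properties as List
import Data.List.Relation.Unary.Unique.Propositional.Properties as Unique
import Data.Nat.Properties as ℕ
import Data.Vec.Properties as Vec
import Relation.Binary.Reasoning.Setoid as SetoidR

-- Restricting to lines means that every test is only ever a function of one variable t, so no
-- multivariate polynomials appear. The value t = 0 sends every direction to p and carries no
-- information; discarding it is what turns q into q - 1. Krylov vectors Aᵏ 1 would give a test of
-- the same degree, but at a diagonal matrix its value is a Vandermonde determinant; the Newton
-- products (A - c₀) ⋯ (A - cₖ₋₁) make it triangular there instead. The constants require n distinct
-- field elements, which exist as soon as n⁴ < q; when q ≤ n⁴ the claimed probability bound is at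
-- most 0. Only one half of (2) is random: a non-zero entry of Aᵏ yields a path for every sample.
-- Determinants are developed over an arbitrary commutative ring because two rings are needed: 𝔽 for
-- the Krylov test, and 𝔽[A] for Cayley-Hamilton. In 𝔽[A] two polynomials count as equal when their
-- values at A agree, so its laws are inherited from matrices and only commutativity has to be
-- added.

-- Determinants over a commutative ring, by Laplace expansion.

module Determinant {c ℓ : Level} (R : CommutativeRing c ℓ) where
  open CommutativeRing R hiding (zero)
  open import Algebra.Properties.Ring ring
  open import Algebra.Properties.Semiring.Sum semiring 
    using (sum; sum-cong-≋; sum-replicate-zero; sum-remove; ∑-comm; *-distribˡ-sum; *-distribʳ-sum)
  open import Algebra.Properties.CommutativeSemigroup *-commutativeSemigroup using (x∙yz≈y∙xz)
  open import Algebra.Properties.CommutativeSemigroup +-commutativeSemigroup using (interchange)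
  open import Relation.Binary.Reasoning.Setoid setoid

  opaque
    alternatingSum : ∀ {n} → (Fin n → Carrier) → Carrier
    alternatingSum {zero}  f = 0#
    alternatingSum {suc n} f = f zero + - alternatingSum (f ∘ suc)

    alternatingSum-[] : (f : Fin 0 → Carrier) → alternatingSum f ≡ 0#
    alternatingSum-[] f = ≡.refl

    alternatingSum-suc : ∀ {n} (f : Fin (suc n) → Carrier) →
      alternatingSum f ≡ f zero + - alternatingSum (f ∘ suc)
    alternatingSum-suc f = ≡.refl

    alternatingSum-cong : ∀ {n} {f g : Fin n → Carrier} → (∀ j → f j ≈ g j) →
      alternatingSum f ≈ alternatingSum g
    alternatingSum-cong {zero}  e = refl
    alternatingSum-cong {suc n} {f} {g} e =
      +-cong (e zero) (-‿cong (alternatingSum-cong {n} {f ∘ suc} {g ∘ suc} (e ∘ suc)))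

    alternatingSum-zero : ∀ {n} {f : Fin n → Carrier} → (∀ j → f j ≈ 0#) → alternatingSum f ≈ 0#
    alternatingSum-zero {zero}  e = refl
    alternatingSum-zero {suc n} {f} e = begin
      f zero + - alternatingSum (f ∘ suc)
        ≈⟨ +-cong (e zero) (-‿cong (alternatingSum-zero {n} {f ∘ suc} (e ∘ suc))) ⟩
      0# + - 0#
        ≈⟨ -‿inverseʳ 0# ⟩
      0# ∎

    alternatingSum-+ : ∀ {n} (f g : Fin n → Carrier) →
      alternatingSum (λ j → f j + g j) ≈ alternatingSum f + alternatingSum g
    alternatingSum-+ {zero}  f g = sym (+-identityˡ 0#)
    alternatingSum-+ {suc n} f g = begin
      (f zero + g zero) + - alternatingSum (λ j → f (suc j) + g (suc j))
        ≈⟨ +-congˡ (-‿cong (alternatingSum-+ (f ∘ suc) (g ∘ suc))) ⟩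
      (f zero + g zero) + - (alternatingSum (f ∘ suc) + alternatingSum (g ∘ suc))
        ≈⟨ +-congˡ (-‿+-comm _ _) ⟨
      (f zero + g zero) + (- alternatingSum (f ∘ suc) + - alternatingSum (g ∘ suc))
        ≈⟨ interchange _ _ _ _ ⟩
      alternatingSum f + alternatingSum g ∎

    alternatingSum-neg : ∀ {n} (f : Fin n → Carrier) →
      alternatingSum (λ j → - f j) ≈ - alternatingSum f
    alternatingSum-neg {zero}  f = sym -0#≈0#
    alternatingSum-neg {suc n} f = begin
      - f zero + - alternatingSum (λ j → - f (suc j)) ≈⟨ +-congˡ (-‿cong (alternatingSum-neg (f ∘ suc))) ⟩
      - f zero + - - alternatingSum (f ∘ suc)         ≈⟨ -‿+-comm _ _ ⟩
      - alternatingSum f                              ∎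

    alternatingSum-* : ∀ {n} x (f : Fin n → Carrier) →
      alternatingSum (λ j → x * f j) ≈ x * alternatingSum f
    alternatingSum-* {zero}  x f = sym (zeroʳ x)
    alternatingSum-* {suc n} x f = begin
      x * f zero + - alternatingSum (λ j → x * f (suc j)) ≈⟨ +-congˡ (-‿cong (alternatingSum-* x (f ∘ suc))) ⟩
      x * f zero + - (x * alternatingSum (f ∘ suc))       ≈⟨ +-congˡ (-‿distribʳ-* _ _) ⟩
      x * f zero + x * - alternatingSum (f ∘ suc)         ≈⟨ distribˡ x _ _ ⟨
      x * alternatingSum f                                ∎

  opaque
    det : ∀ n → (Fin n → Fin n → Carrier) → Carrier
    det zero    M = 1#
    det (suc n) M = alternatingSum (λ j → M zero j * det n (λ r s → M (suc r) (punchIn j s)))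

    det-zero : ∀ M → det 0 M ≡ 1#
    det-zero M = ≡.refl

    det-suc : ∀ {n} M →
      det (suc n) M ≡ alternatingSum (λ j → M zero j * det n (λ r s → M (suc r) (punchIn j s)))
    det-suc M = ≡.refl

    det-cong : ∀ n {M N : Fin n → Fin n → Carrier} → (∀ i j → M i j ≈ N i j) → det n M ≈ det n N
    det-cong zero    e = refl
    det-cong (suc n) {M} {N} e = alternatingSum-cong λ j →
      *-cong (e zero j) (det-cong n {λ r s → M (suc r) (punchIn j s)} {λ r s → N (suc r) (punchIn j s)}
        (λ r s → e (suc r) (punchIn j s)))

  -- Laplace expansion along two rows r and s; m j k plays the role of the
  -- minor with the columns j and punchIn j k deleted.
  doubleExpansion : ∀ {n} → (Fin (suc n) → Carrier) → (Fin (suc n) → Carrier) →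
    (Fin (suc n) → Fin n → Carrier) → Carrier
  doubleExpansion r s m =
    alternatingSum λ j → r j * alternatingSum λ k → s (punchIn j k) * m j k

  -- m j k depends only on the set {j , punchIn j k} of deleted columns.
  DeletionSymmetric : ∀ {n} → (Fin (suc n) → Fin n → Carrier) → Set ℓ
  DeletionSymmetric {zero}  m = ⊤
  DeletionSymmetric {suc n} m =
    (∀ k → m zero k ≈ m (suc k) zero) × DeletionSymmetric (λ j k → m (suc j) (suc k))

  -- `b ↦ punchIn j (punchIn k b)` lists the remaining columns in increasing order, so it does not
  -- depend on the order in which the two columns were deleted. When column 0 remains, the list
  -- starts with it, which is what `lift` records; `F-ext` stands in for function extensionality.
  deletionSymmetric : ∀ {n} (F : (Fin n → Fin (suc (suc n))) → Carrier) →
    (∀ {f g} → (∀ b → f b ≡ g b) → F f ≈ F g) →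
    (m : Fin (suc (suc n)) → Fin (suc n) → Carrier) →
    (∀ j k → m j k ≈ F (λ b → punchIn j (punchIn k b))) → DeletionSymmetric m
  deletionSymmetric {zero}  F F-ext m m≈F = (λ k → trans (m≈F zero k) (trans (F-ext λ ()) (sym (m≈F (suc k) zero)))) , tt
  deletionSymmetric {suc n} F F-ext m m≈F =
    (λ k → trans (m≈F zero k) (trans (F-ext λ { zero → ≡.refl ; (suc b) → ≡.refl }) (sym (m≈F (suc k) zero)))) ,
    deletionSymmetric (F ∘ lift) (λ e → F-ext (lift-ext e)) (λ j k → m (suc j) (suc k))
      (λ j k → trans (m≈F (suc j) (suc k)) (F-ext λ { zero → ≡.refl ; (suc b) → ≡.refl }))
    where
    lift : ∀ {a b} → (Fin a → Fin b) → Fin (suc a) → Fin (suc b)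
    lift f zero    = zero
    lift f (suc i) = suc (f i)
    lift-ext : ∀ {a b} {f g : Fin a → Fin b} → (∀ i → f i ≡ g i) → ∀ i → lift f i ≡ lift g i
    lift-ext e zero    = ≡.refl
    lift-ext e (suc i) = ≡.cong suc (e i)

  -- Separates the pairs of deleted columns that contain column 0. Column 0 is taken either by r or
  -- by s, and by symmetry both cases meet the same minors `m zero k`, with opposite signs. This
  -- antisymmetric part is the reason for the two lemmas that follow.
  doubleExpansion-suc : ∀ {n} (r s : Fin (suc (suc n)) → Carrier) m → DeletionSymmetric m →
    let T = λ (t : Fin (suc (suc n)) → Carrier) → alternatingSum (λ k → t (suc k) * m zero k) in
    doubleExpansion r s m ≈
      (r zero * T s + - (s zero * T r)) +
      doubleExpansion (r ∘ suc) (s ∘ suc) (λ j k → m (suc j) (suc k))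
  doubleExpansion-suc {n} r s m (m₀ , _) = begin
    doubleExpansion r s m
      ≡⟨ alternatingSum-suc _ ⟩
    r zero * T s + - alternatingSum (λ j → r (suc j) * alternatingSum (λ k → s (punchIn (suc j) k) * m (suc j) k))
      ≈⟨ +-congˡ (-‿cong (alternatingSum-cong λ j → *-congˡ (reflexive (alternatingSum-suc _)))) ⟩
    r zero * T s + - alternatingSum (λ j → r (suc j) * (s zero * m (suc j) zero + - X j))
      ≈⟨ +-congˡ (-‿cong (alternatingSum-cong λ j → expand j)) ⟩
    r zero * T s + - alternatingSum (λ j → s zero * (r (suc j) * m zero j) + - (r (suc j) * X j))
      ≈⟨ +-congˡ (-‿cong (trans (alternatingSum-+ _ _) (+-cong (alternatingSum-* _ _) (alternatingSum-neg _)))) ⟩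
    r zero * T s + - (s zero * T r + - S)
      ≈⟨ +-congˡ (-‿+-comm _ _) ⟨
    r zero * T s + (- (s zero * T r) + - - S)
      ≈⟨ +-congˡ (+-congˡ (-‿involutive S)) ⟩
    r zero * T s + (- (s zero * T r) + S)
      ≈⟨ +-assoc _ _ _ ⟨
    (r zero * T s + - (s zero * T r)) + S ∎
    where
    T : (Fin (suc (suc n)) → Carrier) → Carrier
    T t = alternatingSum (λ k → t (suc k) * m zero k)
    S = doubleExpansion (r ∘ suc) (s ∘ suc) (λ j k → m (suc j) (suc k))
    X : Fin (suc n) → Carrier
    X j = alternatingSum (λ k → s (suc (punchIn j k)) * m (suc j) (suc k))
    expand : ∀ j → r (suc j) * (s zero * m (suc j) zero + - X j) ≈
                   s zero * (r (suc j) * m zero j) + - (r (suc j) * X j)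
    expand j = begin
      r (suc j) * (s zero * m (suc j) zero + - X j)
        ≈⟨ distribˡ _ _ _ ⟩
      r (suc j) * (s zero * m (suc j) zero) + r (suc j) * - X j
        ≈⟨ +-cong (x∙yz≈y∙xz _ _ _) (sym (-‿distribʳ-* _ _)) ⟩
      s zero * (r (suc j) * m (suc j) zero) + - (r (suc j) * X j)
        ≈⟨ +-congʳ (*-congˡ (*-congˡ (m₀ j))) ⟨
      s zero * (r (suc j) * m zero j) + - (r (suc j) * X j) ∎

  doubleExpansion-same : ∀ {n} (r : Fin (suc n) → Carrier) m → DeletionSymmetric m →
    doubleExpansion r r m ≈ 0#
  doubleExpansion-same {zero}  r m _ = alternatingSum-zero (λ _ → trans (*-congˡ (reflexive (alternatingSum-[] _))) (zeroʳ _))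
  doubleExpansion-same {suc n} r m σ = begin
    doubleExpansion r r m ≈⟨ doubleExpansion-suc r r m σ ⟩
    _ + _                 ≈⟨ +-cong (-‿inverseʳ _) (doubleExpansion-same (r ∘ suc) _ (proj₂ σ)) ⟩
    0# + 0#               ≈⟨ +-identityˡ 0# ⟩
    0#                    ∎

  doubleExpansion-antisym : ∀ {n} (r s : Fin (suc n) → Carrier) m → DeletionSymmetric m →
    doubleExpansion r s m ≈ - doubleExpansion s r m
  doubleExpansion-antisym {zero} r s m _ = begin
    doubleExpansion r s m   ≈⟨ alternatingSum-zero (λ _ → trans (*-congˡ (reflexive (alternatingSum-[] _))) (zeroʳ _)) ⟩
    0#                      ≈⟨ -0#≈0# ⟨
    - 0#                    ≈⟨ -‿cong (alternatingSum-zero (λ _ → trans (*-congˡ (reflexive (alternatingSum-[] _))) (zeroʳ _))) ⟨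
    - doubleExpansion s r m ∎
  doubleExpansion-antisym {suc n} r s m σ = begin
    doubleExpansion r s m     ≈⟨ doubleExpansion-suc r s m σ ⟩
    (a + - b) + S             ≈⟨ +-cong (sym (trans (sym (-‿+-comm b (- a))) (trans (+-congˡ (-‿involutive a)) (+-comm _ _))))
                                        (doubleExpansion-antisym (r ∘ suc) (s ∘ suc) _ (proj₂ σ)) ⟩
    - (b + - a) + - S′        ≈⟨ -‿+-comm _ _ ⟩
    - ((b + - a) + S′)        ≈⟨ -‿cong (doubleExpansion-suc s r m σ) ⟨
    - doubleExpansion s r m   ∎
    where
    T : (Fin (suc (suc n)) → Carrier) → Carrier
    T t = alternatingSum (λ k → t (suc k) * m zero k)
    a = r zero * T s
    b = s zero * T r
    S = doubleExpansion (r ∘ suc) (s ∘ suc) (λ j k → m (suc j) (suc k))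
    S′ = doubleExpansion (s ∘ suc) (r ∘ suc) (λ j k → m (suc j) (suc k))

  minors-deletionSymmetric : ∀ {n} (N : Fin n → Fin (suc (suc n)) → Carrier) →
    DeletionSymmetric (λ j k → det n (λ a b → N a (punchIn j (punchIn k b))))
  minors-deletionSymmetric {n} N =
    deletionSymmetric (λ f → det n (λ a b → N a (f b)))
      (λ e → det-cong n (λ a b → reflexive (≡.cong (N a) (e b)))) _ (λ j k → refl)

  opaque
    unfolding det

    det-doubleExpansion : ∀ {n} (r s : Fin (suc (suc n)) → Carrier) N →
      det (suc (suc n)) (r ∷ᶠ s ∷ᶠ N) ≡
      doubleExpansion r s (λ j k → det n (λ a b → N a (punchIn j (punchIn k b))))
    det-doubleExpansion r s N = ≡.refl

  det-swap : ∀ {n} (r s : Fin (suc (suc n)) → Carrier) N →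
    det (suc (suc n)) (r ∷ᶠ s ∷ᶠ N) ≈ - det (suc (suc n)) (s ∷ᶠ r ∷ᶠ N)
  det-swap {n} r s N = begin
    det (suc (suc n)) (r ∷ᶠ s ∷ᶠ N)   ≡⟨ det-doubleExpansion r s N ⟩
    doubleExpansion r s _           ≈⟨ doubleExpansion-antisym r s _ (minors-deletionSymmetric N) ⟩
    - doubleExpansion s r _         ≡⟨ ≡.cong -_ (det-doubleExpansion s r N) ⟨
    - det (suc (suc n)) (s ∷ᶠ r ∷ᶠ N) ∎

  det-tail-cong : ∀ {n} (r : Fin (suc n) → Carrier) {N N′ : Fin n → Fin (suc n) → Carrier} →
    (∀ i j → N i j ≈ N′ i j) → det (suc n) (r ∷ᶠ N) ≈ det (suc n) (r ∷ᶠ N′)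
  det-tail-cong r e = det-cong _ λ { zero j → refl ; (suc i) j → e i j }

  -- If the copy of the first row is not adjacent to it, swapping the top two rows and expanding
  -- along the new top row leaves minors that again have a copy of a lower row on top.
  det-repeated : ∀ {n} (N : Fin n → Fin (suc n) → Carrier) i → det (suc n) (N i ∷ᶠ N) ≈ 0#
  det-repeated {suc n} N zero = begin
    det (suc (suc n)) (N zero ∷ᶠ N)
      ≈⟨ det-tail-cong _ (λ { zero j → refl ; (suc k) j → refl }) ⟩
    det (suc (suc n)) (N zero ∷ᶠ N zero ∷ᶠ (N ∘ suc))
      ≡⟨ det-doubleExpansion _ _ _ ⟩
    doubleExpansion (N zero) (N zero) _
      ≈⟨ doubleExpansion-same (N zero) _ (minors-deletionSymmetric (N ∘ suc)) ⟩
    0# ∎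
  det-repeated {suc n} N (suc i) = begin
    det (suc (suc n)) (N (suc i) ∷ᶠ N)
      ≈⟨ det-tail-cong _ (λ { zero j → refl ; (suc k) j → refl }) ⟩
    det (suc (suc n)) (N (suc i) ∷ᶠ N zero ∷ᶠ (N ∘ suc))
      ≈⟨ det-swap (N (suc i)) (N zero) (N ∘ suc) ⟩
    - det (suc (suc n)) (N zero ∷ᶠ N (suc i) ∷ᶠ (N ∘ suc))
      ≈⟨ -‿cong (trans (reflexive (det-suc _)) (alternatingSum-zero λ j → trans (*-congˡ (trans (det-cong (suc n) λ { zero b → refl ; (suc a) b → refl })
           (det-repeated (λ a b → N (suc a) (punchIn j b)) i))) (zeroʳ _))) ⟩
    - 0#
      ≈⟨ -0#≈0# ⟩
    0# ∎

  sign : ∀ {n} → Fin n → Carrier → Carrier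
  sign zero    x = x
  sign (suc k) x = - sign k x

  sign-cong : ∀ {n} (k : Fin n) {x y} → x ≈ y → sign k x ≈ sign k y
  sign-cong zero    e = e
  sign-cong (suc k) e = -‿cong (sign-cong k e)

  sign-* : ∀ {n} (k : Fin n) x y → x * sign k y ≈ sign k (x * y)
  sign-* zero    x y = refl
  sign-* (suc k) x y = trans (sym (-‿distribʳ-* _ _)) (-‿cong (sign-* k x y))

  sign-0 : ∀ {n} (k : Fin n) → sign k 0# ≈ 0#
  sign-0 zero    = refl
  sign-0 (suc k) = trans (-‿cong (sign-0 k)) -0#≈0#

  sign-neg : ∀ {n} (k : Fin n) x → sign k (- x) ≈ - sign k x
  sign-neg zero    x = refl
  sign-neg (suc k) x = -‿cong (sign-neg k x)

  sign-+ : ∀ {n} (k : Fin n) x y → sign k x + sign k y ≈ sign k (x + y)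
  sign-+ zero    x y = refl
  sign-+ (suc k) x y = trans (-‿+-comm _ _) (-‿cong (sign-+ k x y))

  sign-sum : ∀ {m} n (k : Fin m) (f : Fin n → Carrier) → sum (λ j → sign k (f j)) ≈ sign k (sum f)
  sign-sum zero    k f = sym (sign-0 k)
  sign-sum (suc n) k f = trans (+-congˡ (sign-sum n k (f ∘ suc))) (sign-+ k (f zero) _)

  alternatingSum-sign : ∀ {n m} (k : Fin m) (f : Fin n → Carrier) →
    alternatingSum (λ j → sign k (f j)) ≈ sign k (alternatingSum f)
  alternatingSum-sign zero    f = refl
  alternatingSum-sign (suc k) f =
    trans (alternatingSum-neg (λ j → sign k (f j))) (-‿cong (alternatingSum-sign k f))

  alternatingSum≈sum : ∀ n (f : Fin n → Carrier) → alternatingSum f ≈ sum (λ j → sign j (f j))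
  alternatingSum≈sum zero    f = reflexive (alternatingSum-[] f)
  alternatingSum≈sum (suc n) f = begin
    alternatingSum f                                  ≡⟨ alternatingSum-suc f ⟩
    f zero + - alternatingSum (f ∘ suc)               ≈⟨ +-congˡ (-‿cong (alternatingSum≈sum n (f ∘ suc))) ⟩
    f zero + - sum (λ j → sign j (f (suc j)))         ≈⟨ +-congˡ (sign-sum {2} n (suc zero) (λ j → sign j (f (suc j)))) ⟨
    f zero + sum (λ j → - sign j (f (suc j)))         ∎

  -- Row k passes k rows on its way up, one swap for each: inside the minors it is moved to the
  -- second place, and one swap of the top two rows finishes.
  det-toTop : ∀ {n} (M : Fin (suc n) → Fin (suc n) → Carrier) k →
    det (suc n) M ≈ sign k (det (suc n) (M k ∷ᶠ removeAt M k))
  det-toTop M zero = det-cong _ λ { zero j → refl ; (suc i) j → refl }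
  det-toTop {suc n} M (suc k) = begin
    det (suc (suc n)) M
      ≡⟨ det-suc M ⟩
    alternatingSum (λ j → M zero j * det (suc n) (λ a b → M (suc a) (punchIn j b)))
      ≈⟨ alternatingSum-cong (λ j → trans (*-congˡ (det-toTop (λ a b → M (suc a) (punchIn j b)) k)) (sign-* k _ _)) ⟩
    alternatingSum (λ j → sign k (M zero j * _))
      ≈⟨ alternatingSum-sign k _ ⟩
    sign k (alternatingSum (λ j → M zero j * _))
      ≈⟨ sign-cong k (alternatingSum-cong λ j → *-congˡ {M zero j} (det-cong (suc n) λ { zero b → refl ; (suc a) b → refl })) ⟩
    sign k (alternatingSum (λ j → M zero j * det (suc n) (λ a b → (M (suc k) ∷ᶠ removeAt (M ∘ suc) k) a (punchIn j b))))
      ≡⟨ ≡.cong (sign k) (det-suc _) ⟨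
    sign k (det (suc (suc n)) (M zero ∷ᶠ M (suc k) ∷ᶠ removeAt (M ∘ suc) k))
      ≈⟨ sign-cong k (det-swap (M zero) (M (suc k)) _) ⟩
    sign k (- det (suc (suc n)) (M (suc k) ∷ᶠ M zero ∷ᶠ removeAt (M ∘ suc) k))
      ≈⟨ sign-neg k _ ⟩
    - sign k (det (suc (suc n)) (M (suc k) ∷ᶠ M zero ∷ᶠ removeAt (M ∘ suc) k))
      ≈⟨ -‿cong (sign-cong k (det-tail-cong _ λ { zero j → refl ; (suc i) j → refl })) ⟩
    - sign k (det (suc (suc n)) (M (suc k) ∷ᶠ removeAt M (suc k))) ∎

  cofactor : ∀ {n} → (Fin n → Fin n → Carrier) → Fin n → Fin n → Carrier
  cofactor {suc n} M k j = sign k (sign j (det n (λ a b → M (punchIn k a) (punchIn j b))))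

  -- The row r is left free so that one expansion serves twice: r = `M k` recovers the determinant,
  -- while r = `M i` with i ≠ k gives a matrix with a repeated row.
  expand-cofactor : ∀ {n} (M : Fin (suc n) → Fin (suc n) → Carrier) k (r : Fin (suc n) → Carrier) →
    sum (λ j → r j * cofactor M k j) ≈ sign k (det (suc n) (r ∷ᶠ removeAt M k))
  expand-cofactor {n} M k r = begin
    sum (λ j → r j * cofactor M k j)
      ≈⟨ sum-cong-≋ {suc n} (λ j → trans (sign-* k (r j) _) (sign-cong k (sign-* j (r j) (minor j)))) ⟩
    sum (λ j → sign k (sign j (r j * minor j)))
      ≈⟨ sign-sum (suc n) k (λ j → sign j (r j * minor j)) ⟩
    sign k (sum (λ j → sign j (r j * minor j)))
      ≈⟨ sign-cong k (alternatingSum≈sum (suc n) (λ j → r j * minor j)) ⟨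
    sign k (alternatingSum (λ j → r j * minor j))
      ≡⟨ ≡.cong (sign k) (det-suc _) ⟨
    sign k (det (suc n) (r ∷ᶠ removeAt M k)) ∎
    where
    minor : Fin (suc n) → Carrier
    minor j = det n (λ a b → M (punchIn k a) (punchIn j b))

  cofactor-same : ∀ {n} (M : Fin n → Fin n → Carrier) k → sum (λ j → M k j * cofactor M k j) ≈ det n M
  cofactor-same {suc n} M k = trans (expand-cofactor M k (M k)) (sym (det-toTop M k))

  cofactor-other : ∀ {n} (M : Fin n → Fin n → Carrier) k i → ¬ (k ≡ i) →
    sum (λ j → M i j * cofactor M k j) ≈ 0#
  cofactor-other {suc n} M k i k≢i = begin
    sum (λ j → M i j * cofactor M k j)
      ≈⟨ expand-cofactor M k (M i) ⟩
    sign k (det (suc n) (M i ∷ᶠ removeAt M k))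
      ≡⟨ ≡.cong (λ i → sign k (det (suc n) (M i ∷ᶠ removeAt M k))) (punchIn-punchOut k≢i) ⟨
    sign k (det (suc n) (removeAt M k (punchOut k≢i) ∷ᶠ removeAt M k))
      ≈⟨ sign-cong k (det-repeated (removeAt M k) (punchOut k≢i)) ⟩
    sign k 0#
      ≈⟨ sign-0 k ⟩
    0# ∎

  det-lowerTriangular : ∀ n (M : Fin (suc n) → Fin (suc n) → Carrier) → (∀ j → M zero (suc j) ≈ 0#) →
    det (suc n) M ≈ M zero zero * det n (λ i j → M (suc i) (suc j))
  det-lowerTriangular n M z = begin
    det (suc n) M
      ≡⟨ ≡.trans (det-suc M) (alternatingSum-suc _) ⟩
    M zero zero * _ + - _
      ≈⟨ +-congˡ (trans (-‿cong (alternatingSum-zero λ j → trans (*-congʳ (z j)) (zeroˡ _))) -0#≈0#) ⟩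
    M zero zero * _ + 0#
      ≈⟨ +-identityʳ _ ⟩
    M zero zero * det n (λ i j → M (suc i) (suc j)) ∎

  -- Multiply w M = 0 on the right by the adjugate: M times its adjugate is det M times the
  -- identity, so coordinate k becomes `w k * det n M`. No division is involved.
  leftKernel : ∀ {n} (M : Fin n → Fin n → Carrier) (w : Fin n → Carrier) →
    (∀ j → sum (λ i → w i * M i j) ≈ 0#) → ∀ k → w k * det n M ≈ 0#
  leftKernel {n} M w wM≈0 k = begin
    w k * det n M
      ≈⟨ sum-single k (λ i → w i * sum (λ j → M i j * cofactor M k j))
           (λ i k≢i → trans (*-congˡ (cofactor-other M k i k≢i)) (zeroʳ (w i)))
           (*-congˡ (cofactor-same M k)) ⟨
    sum (λ i → w i * sum (λ j → M i j * cofactor M k j))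
      ≈⟨ sum-cong-≋ {n} (λ i → trans (*-distribˡ-sum (w i) (λ j → M i j * cofactor M k j))
           (sum-cong-≋ {n} (λ j → sym (*-assoc (w i) (M i j) (cofactor M k j))))) ⟩
    sum (λ i → sum (λ j → w i * M i j * cofactor M k j))
      ≈⟨ ∑-comm (λ i j → w i * M i j * cofactor M k j) ⟩
    sum (λ j → sum (λ i → w i * M i j * cofactor M k j))
      ≈⟨ sum-cong-≋ {n} (λ j → trans (sym (*-distribʳ-sum (cofactor M k j) (λ i → w i * M i j)))
           (trans (*-congʳ (wM≈0 j)) (zeroˡ (cofactor M k j)))) ⟩
    sum {n} (λ j → 0#)
      ≈⟨ sum-replicate-zero n ⟩
    0# ∎
    where
    sum-single : ∀ {n} (k : Fin n) (f : Fin n → Carrier) {x} →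
      (∀ i → ¬ (k ≡ i) → f i ≈ 0#) → f k ≈ x → sum f ≈ x
    sum-single {suc n} k f {x} f≈0 fk≈x = begin
      sum f                   ≈⟨ sum-remove {i = k} f ⟩
      f k + sum (removeAt f k) ≈⟨ +-cong fk≈x (trans (sum-cong-≋ {n} (λ i → f≈0 (punchIn k i) (λ e → punchInᵢ≢i k i (≡.sym e)))) (sum-replicate-zero n)) ⟩
      x + 0#                  ≈⟨ +-identityʳ x ⟩
      x                       ∎

-- The ring of square matrices over the field.

module Matrices {c ℓ : Level} (𝔽 : FiniteField c ℓ) where
  open FiniteField 𝔽 hiding (zero)
  open CommutativeRing commRing public using (ring)
  open import Algebra.Properties.Semiring.Sum semiring public
    using (sum; sum-cong-≋; sum-replicate-zero; ∑-distrib-+; ∑-comm; *-distribˡ-sum; *-distribʳ-sum)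
  open import Relation.Binary.Reasoning.Setoid setoid

  infixl 7 _⊗ᴹ_
  infixl 6 _+ᴹ_
  infix 4 _≈ᴹ_

  _⊗ᴹ_ : ∀ {n} → Mat 𝔽 n → Mat 𝔽 n → Mat 𝔽 n
  _⊗ᴹ_ = _⊗_ 𝔽

  _+ᴹ_ : ∀ {n} → Mat 𝔽 n → Mat 𝔽 n → Mat 𝔽 n
  (A +ᴹ B) i j = A i j + B i j

  -ᴹ_ : ∀ {n} → Mat 𝔽 n → Mat 𝔽 n
  (-ᴹ A) i j = - A i j

  _≈ᴹ_ : ∀ {n} → Mat 𝔽 n → Mat 𝔽 n → Set ℓ
  A ≈ᴹ B = ∀ i j → A i j ≈ B i j

  ∑≡sum : ∀ {n} (f : Fin n → Carrier) → ∑ 𝔽 f ≡ sum f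
  ∑≡sum {zero}  f = ≡.refl
  ∑≡sum {suc n} f = ≡.cong (f zero +_) (∑≡sum (f ∘ suc))

  ⊗-sum : ∀ {n} (A B : Mat 𝔽 n) i j → (A ⊗ᴹ B) i j ≈ sum (λ k → A i k * B k j)
  ⊗-sum A B i j = reflexive (∑≡sum (λ k → A i k * B k j))

  sum-zero : ∀ {n} {f : Fin n → Carrier} → (∀ i → f i ≈ 0#) → sum f ≈ 0#
  sum-zero {n} {f} e = trans (sum-cong-≋ {n} {f} {λ _ → 0#} e) (sum-replicate-zero n)

  idM-sym : ∀ {n} (i j : Fin n) → idM 𝔽 i j ≡ idM 𝔽 j i
  idM-sym zero    zero    = ≡.refl
  idM-sym zero    (suc j) = ≡.refl
  idM-sym (suc i) zero    = ≡.refl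
  idM-sym (suc i) (suc j) = idM-sym i j

  sum-idM : ∀ {n} (i : Fin n) (f : Fin n → Carrier) → sum (λ k → idM 𝔽 i k * f k) ≈ f i
  sum-idM {suc n} zero f = begin
    1# * f zero + sum (λ k → 0# * f (suc k)) ≈⟨ +-cong (*-identityˡ _) (sum-zero (λ k → zeroˡ (f (suc k)))) ⟩
    f zero + 0#                              ≈⟨ +-identityʳ _ ⟩
    f zero                                   ∎
  sum-idM {suc n} (suc i) f = begin
    0# * f zero + sum (λ k → idM 𝔽 i k * f (suc k)) ≈⟨ +-cong (zeroˡ _) (sum-idM i (f ∘ suc)) ⟩
    0# + f (suc i)                                  ≈⟨ +-identityˡ _ ⟩
    f (suc i)                                       ∎

  ⊗-cong : ∀ {n} {A A′ B B′ : Mat 𝔽 n} → A ≈ᴹ A′ → B ≈ᴹ B′ → A ⊗ᴹ B ≈ᴹ A′ ⊗ᴹ B′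
  ⊗-cong {n} {A} {A′} {B} {B′} a b i j = begin
    (A ⊗ᴹ B) i j               ≈⟨ ⊗-sum A B i j ⟩
    sum (λ k → A i k * B k j)   ≈⟨ sum-cong-≋ {n} (λ k → *-cong (a i k) (b k j)) ⟩
    sum (λ k → A′ i k * B′ k j) ≈⟨ ⊗-sum A′ B′ i j ⟨
    (A′ ⊗ᴹ B′) i j             ∎

  ⊗-assoc : ∀ {n} (A B C : Mat 𝔽 n) → (A ⊗ᴹ B) ⊗ᴹ C ≈ᴹ A ⊗ᴹ (B ⊗ᴹ C)
  ⊗-assoc {n} A B C i j = begin
    ((A ⊗ᴹ B) ⊗ᴹ C) i j
      ≈⟨ ⊗-sum (A ⊗ᴹ B) C i j ⟩
    sum (λ k → (A ⊗ᴹ B) i k * C k j)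
      ≈⟨ sum-cong-≋ {n} (λ k → trans (*-congʳ (⊗-sum A B i k)) (*-distribʳ-sum (C k j) (λ l → A i l * B l k))) ⟩
    sum (λ k → sum (λ l → A i l * B l k * C k j))
      ≈⟨ ∑-comm (λ k l → A i l * B l k * C k j) ⟩
    sum (λ l → sum (λ k → A i l * B l k * C k j))
      ≈⟨ sum-cong-≋ {n} (λ l → sum-cong-≋ {n} (λ k → *-assoc (A i l) (B l k) (C k j))) ⟩
    sum (λ l → sum (λ k → A i l * (B l k * C k j)))
      ≈⟨ sum-cong-≋ {n} (λ l → trans (*-congˡ (⊗-sum B C l j)) (*-distribˡ-sum (A i l) (λ k → B l k * C k j))) ⟨
    sum (λ l → A i l * (B ⊗ᴹ C) l j)
      ≈⟨ ⊗-sum A (B ⊗ᴹ C) i j ⟨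
    (A ⊗ᴹ (B ⊗ᴹ C)) i j ∎

  ⊗-identityˡ : ∀ {n} (A : Mat 𝔽 n) → idM 𝔽 ⊗ᴹ A ≈ᴹ A
  ⊗-identityˡ A i j = trans (⊗-sum (idM 𝔽) A i j) (sum-idM i (λ k → A k j))

  ⊗-identityʳ : ∀ {n} (A : Mat 𝔽 n) → A ⊗ᴹ idM 𝔽 ≈ᴹ A
  ⊗-identityʳ {n} A i j = begin
    (A ⊗ᴹ idM 𝔽) i j                ≈⟨ ⊗-sum A (idM 𝔽) i j ⟩
    sum (λ k → A i k * idM 𝔽 k j)   ≈⟨ sum-cong-≋ {n} (λ k → trans (*-comm (A i k) _) (*-congʳ (reflexive (idM-sym k j)))) ⟩
    sum (λ k → idM 𝔽 j k * A i k)   ≈⟨ sum-idM j (A i) ⟩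
    A i j                           ∎

  ⊗-distribˡ : ∀ {n} (A B C : Mat 𝔽 n) → A ⊗ᴹ (B +ᴹ C) ≈ᴹ A ⊗ᴹ B +ᴹ A ⊗ᴹ C
  ⊗-distribˡ {n} A B C i j = begin
    (A ⊗ᴹ (B +ᴹ C)) i j
      ≈⟨ ⊗-sum A (B +ᴹ C) i j ⟩
    sum (λ k → A i k * (B k j + C k j))
      ≈⟨ sum-cong-≋ {n} (λ k → distribˡ (A i k) (B k j) (C k j)) ⟩
    sum (λ k → A i k * B k j + A i k * C k j)
      ≈⟨ ∑-distrib-+ (λ k → A i k * B k j) (λ k → A i k * C k j) ⟩
    sum (λ k → A i k * B k j) + sum (λ k → A i k * C k j)
      ≈⟨ +-cong (⊗-sum A B i j) (⊗-sum A C i j) ⟨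
    (A ⊗ᴹ B) i j + (A ⊗ᴹ C) i j ∎

  ⊗-distribʳ : ∀ {n} (A B C : Mat 𝔽 n) → (B +ᴹ C) ⊗ᴹ A ≈ᴹ B ⊗ᴹ A +ᴹ C ⊗ᴹ A
  ⊗-distribʳ {n} A B C i j = begin
    ((B +ᴹ C) ⊗ᴹ A) i j
      ≈⟨ ⊗-sum (B +ᴹ C) A i j ⟩
    sum (λ k → (B i k + C i k) * A k j)
      ≈⟨ sum-cong-≋ {n} (λ k → distribʳ (A k j) (B i k) (C i k)) ⟩
    sum (λ k → B i k * A k j + C i k * A k j)
      ≈⟨ ∑-distrib-+ (λ k → B i k * A k j) (λ k → C i k * A k j) ⟩
    sum (λ k → B i k * A k j) + sum (λ k → C i k * A k j)
      ≈⟨ +-cong (⊗-sum B A i j) (⊗-sum C A i j) ⟨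
    (B ⊗ᴹ A) i j + (C ⊗ᴹ A) i j ∎

  matrixRing : ℕ → Ring c ℓ
  matrixRing n = record
    { Carrier = Mat 𝔽 n
    ; _≈_     = _≈ᴹ_
    ; _+_     = _+ᴹ_
    ; _*_     = _⊗ᴹ_
    ; -_      = -ᴹ_
    ; 0#      = zeroM 𝔽
    ; 1#      = idM 𝔽
    ; isRing  = record
      { +-isAbelianGroup = Pointwise.isAbelianGroup (Fin n) (Pointwise.isAbelianGroup (Fin n) +-isAbelianGroup)
      ; *-cong           = λ {A} {A′} {B} {B′} → ⊗-cong {n} {A} {A′} {B} {B′}
      ; *-assoc          = ⊗-assoc
      ; *-identity       = ⊗-identityˡ , ⊗-identityʳ
      ; distrib          = ⊗-distribˡ , ⊗-distribʳ
      }
    }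

  scalar : ∀ {n} → Carrier → Mat 𝔽 n
  scalar a i j = a * idM 𝔽 i j

  infixr 8 _•_
  _•_ : ∀ {n} → Carrier → Mat 𝔽 n → Mat 𝔽 n
  (a • A) i j = a * A i j

  •-⊗ : ∀ {n} a (A B : Mat 𝔽 n) → (a • A) ⊗ᴹ B ≈ᴹ a • (A ⊗ᴹ B)
  •-⊗ {n} a A B i j = begin
    ((a • A) ⊗ᴹ B) i j               ≈⟨ ⊗-sum (a • A) B i j ⟩
    sum (λ k → a * A i k * B k j)     ≈⟨ sum-cong-≋ {n} (λ k → *-assoc a (A i k) (B k j)) ⟩
    sum (λ k → a * (A i k * B k j))   ≈⟨ *-distribˡ-sum a (λ k → A i k * B k j) ⟨
    a * sum (λ k → A i k * B k j)     ≈⟨ *-congˡ (⊗-sum A B i j) ⟨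
    a * (A ⊗ᴹ B) i j                 ∎

  ⊗-• : ∀ {n} a (A B : Mat 𝔽 n) → A ⊗ᴹ (a • B) ≈ᴹ a • (A ⊗ᴹ B)
  ⊗-• {n} a A B i j = begin
    (A ⊗ᴹ (a • B)) i j               ≈⟨ ⊗-sum A (a • B) i j ⟩
    sum (λ k → A i k * (a * B k j))   ≈⟨ sum-cong-≋ {n} (λ k → x∙yz≈y∙xz (A i k) a (B k j)) ⟩
    sum (λ k → a * (A i k * B k j))   ≈⟨ *-distribˡ-sum a (λ k → A i k * B k j) ⟨
    a * sum (λ k → A i k * B k j)     ≈⟨ *-congˡ (⊗-sum A B i j) ⟨
    a * (A ⊗ᴹ B) i j                 ∎
    where open import Algebra.Properties.CommutativeSemigroup *-commutativeSemigroup using (x∙yz≈y∙xz)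

  scalar-⊗ : ∀ {n} a (B : Mat 𝔽 n) → scalar a ⊗ᴹ B ≈ᴹ a • B
  scalar-⊗ a B i j = trans (•-⊗ a (idM 𝔽) B i j) (*-congˡ (⊗-identityˡ B i j))

  ⊗-scalar : ∀ {n} a (B : Mat 𝔽 n) → B ⊗ᴹ scalar a ≈ᴹ a • B
  ⊗-scalar a B i j = trans (⊗-• a B (idM 𝔽) i j) (*-congˡ (⊗-identityʳ B i j))

-- Cayley-Hamilton through the commutative ring 𝔽[A].

module CayleyHamilton {c ℓ : Level} (𝔽 : FiniteField c ℓ) {n : ℕ} (A : Mat 𝔽 n) where
  open FiniteField 𝔽 hiding (zero)
  open Matrices 𝔽
  open import Algebra.Properties.Ring ring
  open import Algebra.Properties.CommutativeSemigroup +-commutativeSemigroup using (interchange)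
  private
    module M where
      open Ring (matrixRing n) public
      open import Algebra.Properties.Ring (matrixRing n) public
  open import Relation.Binary.Reasoning.Setoid M.setoid

  private module SetoidReasoning = SetoidR setoid

  ev : Poly 𝔽 → Mat 𝔽 n
  ev p = evalP 𝔽 p A

  ev-+ : ∀ p q → ev (_+P_ 𝔽 p q) ≈ᴹ ev p +ᴹ ev q
  ev-+ []      q       i j = sym (+-identityˡ _)
  ev-+ (a ∷ p) []      i j = sym (+-identityʳ _)
  ev-+ (a ∷ p) (b ∷ q) i j = trans
    (+-cong (distribʳ _ a b) (trans (⊗-cong {n} {A} {A} (λ _ _ → refl) (ev-+ p q) i j) (⊗-distribˡ A (ev p) (ev q) i j)))
    (interchange _ _ _ _)

  ev-map : ∀ a q → ev (map (a *_) q) ≈ᴹ a • ev q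
  ev-map a []      i j = sym (zeroʳ a)
  ev-map a (b ∷ q) i j = trans
    (+-cong (*-assoc a b _) (trans (⊗-cong {n} {A} {A} (λ _ _ → refl) (ev-map a q) i j) (⊗-• a A (ev q) i j)))
    (sym (distribˡ a _ _))

  ev-neg : ∀ q → ev (-P_ 𝔽 q) ≈ᴹ -ᴹ ev q
  ev-neg []      i j = sym -0#≈0#
  ev-neg (b ∷ q) i j = trans
    (+-cong (sym (-‿distribˡ-* b _)) (trans (⊗-cong {n} {A} {A} (λ _ _ → refl) (ev-neg q) i j)
                                           (M.sym (M.-‿distribʳ-* A (ev q)) i j)))
    (-‿+-comm _ _)

  ev-const : ∀ a → ev (constP 𝔽 a) ≈ᴹ scalar a
  ev-const a i j = trans (+-congˡ (M.zeroʳ A i j)) (+-identityʳ _)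

  ev-0∷ : ∀ p → ev (0# ∷ p) ≈ᴹ A ⊗ᴹ ev p
  ev-0∷ p i j = trans (+-congʳ (zeroˡ _)) (+-identityˡ _)

  ev-one : ev (constP 𝔽 1#) ≈ᴹ idM 𝔽
  ev-one i j = trans (ev-const 1# i j) (*-identityˡ _)

  ev-X : ev (varX 𝔽) ≈ᴹ A
  ev-X = begin
    ev (varX 𝔽)            ≈⟨ ev-0∷ (constP 𝔽 1#) ⟩
    A ⊗ᴹ ev (constP 𝔽 1#)  ≈⟨ M.*-congˡ {A} ev-one ⟩
    A ⊗ᴹ idM 𝔽             ≈⟨ M.*-identityʳ A ⟩
    A                      ∎

  ev-* : ∀ p q → ev (_*P_ 𝔽 p q) ≈ᴹ ev p ⊗ᴹ ev q
  ev-* []      q = M.sym (M.zeroˡ (ev q))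
  ev-* (a ∷ p) q = begin
    ev (_+P_ 𝔽 (map (a *_) q) (0# ∷ _*P_ 𝔽 p q))  ≈⟨ ev-+ (map (a *_) q) _ ⟩
    ev (map (a *_) q) +ᴹ ev (0# ∷ _*P_ 𝔽 p q)     ≈⟨ M.+-cong (ev-map a q) (ev-0∷ (_*P_ 𝔽 p q)) ⟩
    a • ev q +ᴹ A ⊗ᴹ ev (_*P_ 𝔽 p q)              ≈⟨ M.+-cong (M.sym (scalar-⊗ a (ev q))) (M.*-congˡ {A} (ev-* p q)) ⟩
    scalar a ⊗ᴹ ev q +ᴹ A ⊗ᴹ (ev p ⊗ᴹ ev q)       ≈⟨ M.+-congˡ {scalar a ⊗ᴹ ev q} (M.*-assoc A (ev p) (ev q)) ⟨
    scalar a ⊗ᴹ ev q +ᴹ (A ⊗ᴹ ev p) ⊗ᴹ ev q       ≈⟨ M.distribʳ (ev q) (scalar a) (A ⊗ᴹ ev p) ⟨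
    ev (a ∷ p) ⊗ᴹ ev q                            ∎

  ⊗-ev-comm : ∀ (B : Mat 𝔽 n) → A ⊗ᴹ B ≈ᴹ B ⊗ᴹ A → ∀ p → ev p ⊗ᴹ B ≈ᴹ B ⊗ᴹ ev p
  ⊗-ev-comm B comm []      = M.trans (M.zeroˡ B) (M.sym (M.zeroʳ B))
  ⊗-ev-comm B comm (a ∷ p) = begin
    (scalar a +ᴹ A ⊗ᴹ ev p) ⊗ᴹ B       ≈⟨ M.distribʳ B (scalar a) (A ⊗ᴹ ev p) ⟩
    scalar a ⊗ᴹ B +ᴹ A ⊗ᴹ ev p ⊗ᴹ B    ≈⟨ M.+-cong (M.trans (scalar-⊗ a B) (M.sym (⊗-scalar a B))) (M.*-assoc A (ev p) B) ⟩
    B ⊗ᴹ scalar a +ᴹ A ⊗ᴹ (ev p ⊗ᴹ B)  ≈⟨ M.+-congˡ {B ⊗ᴹ scalar a} (M.*-congˡ {A} (⊗-ev-comm B comm p)) ⟩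
    B ⊗ᴹ scalar a +ᴹ A ⊗ᴹ (B ⊗ᴹ ev p)  ≈⟨ M.+-congˡ {B ⊗ᴹ scalar a} (M.*-assoc A B (ev p)) ⟨
    B ⊗ᴹ scalar a +ᴹ A ⊗ᴹ B ⊗ᴹ ev p    ≈⟨ M.+-congˡ {B ⊗ᴹ scalar a} (M.*-congʳ {ev p} comm) ⟩
    B ⊗ᴹ scalar a +ᴹ B ⊗ᴹ A ⊗ᴹ ev p    ≈⟨ M.+-congˡ {B ⊗ᴹ scalar a} (M.*-assoc B A (ev p)) ⟩
    B ⊗ᴹ scalar a +ᴹ B ⊗ᴹ (A ⊗ᴹ ev p)  ≈⟨ M.distribˡ B (scalar a) (A ⊗ᴹ ev p) ⟨
    B ⊗ᴹ (scalar a +ᴹ A ⊗ᴹ ev p)       ∎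

  ev-comm : ∀ p q → ev p ⊗ᴹ ev q ≈ᴹ ev q ⊗ᴹ ev p
  ev-comm p q = ⊗-ev-comm (ev q) (M.sym (⊗-ev-comm A M.refl q)) p

  -- The commutative ring 𝔽[A], with polynomials as names of its elements.
  𝔽[A] : CommutativeRing c ℓ
  𝔽[A] = record
    { isCommutativeRing = record
      { isRing = RingMonomorphism.isRing monomorphism M.isRing
      ; *-comm = λ p q → M.trans (ev-* p q) (M.trans (ev-comm p q) (M.sym (ev-* q p)))
      }
    }
    where
    polynomials : RawRing c ℓ
    polynomials = record
      { Carrier = Poly 𝔽 ; _≈_ = λ p q → ev p ≈ᴹ ev q
      ; _+_ = _+P_ 𝔽 ; _*_ = _*P_ 𝔽 ; -_ = -P_ 𝔽 ; 0# = [] ; 1# = constP 𝔽 1# }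
    open RingMorphisms polynomials M.rawRing
    monomorphism : IsRingMonomorphism ev
    monomorphism = record
      { isRingHomomorphism = record
        { isSemiringHomomorphism = record
          { isNearSemiringHomomorphism = record
            { +-isMonoidHomomorphism = record
              { isMagmaHomomorphism = record
                { isRelHomomorphism = record { cong = id }
                ; homo = ev-+ }
              ; ε-homo = M.refl }
            ; *-homo = ev-* }
          ; 1#-homo = ev-one }
        ; -‿homo = ev-neg }
      ; injective = id }

  private
    module P = CommutativeRing 𝔽[A]
    module D = Determinant 𝔽[A]
    module PR = SetoidR P.setoid
    module PS = SemiringSum P.semiring

  altSum≈alternatingSum : ∀ {m} (f : Fin m → Poly 𝔽) → altSum 𝔽 f P.≈ D.alternatingSum f
  altSum≈alternatingSum {zero}  f = P.reflexive (≡.sym (D.alternatingSum-[] f))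
  altSum≈alternatingSum {suc m} f = PR.begin
    altSum 𝔽 f
      PR.≈⟨ P.+-congˡ {f zero} (P.-‿cong {altSum 𝔽 (f ∘ suc)} {D.alternatingSum (f ∘ suc)} (altSum≈alternatingSum (f ∘ suc))) ⟩
    f zero P.+ P.- D.alternatingSum (f ∘ suc)
      PR.≡⟨ D.alternatingSum-suc f ⟨
    D.alternatingSum f PR.∎

  detP≈det : ∀ m (N : Fin m → Fin m → Poly 𝔽) → detP 𝔽 m N P.≈ D.det m N
  detP≈det zero    N = P.reflexive (≡.sym (D.det-zero N))
  detP≈det (suc m) N = PR.begin
    detP 𝔽 (suc m) N
      PR.≈⟨ altSum≈alternatingSum (λ j → N zero j P.* detP 𝔽 m (minor j)) ⟩
    D.alternatingSum (λ j → N zero j P.* detP 𝔽 m (minor j))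
      PR.≈⟨ D.alternatingSum-cong (λ j → P.*-congˡ {N zero j} {detP 𝔽 m (minor j)} {D.det m (minor j)} (detP≈det m (minor j))) ⟩
    D.alternatingSum (λ j → N zero j P.* D.det m (minor j))
      PR.≡⟨ D.det-suc N ⟨
    D.det (suc m) N PR.∎
    where
    minor : Fin (suc m) → Fin m → Fin m → Poly 𝔽
    minor j r s = N (suc r) (punchIn j s)

  charEntry : Fin n → Fin n → Poly 𝔽
  charEntry i j = if does (i ≟ j) then _+P_ 𝔽 (varX 𝔽) (-P_ 𝔽 (constP 𝔽 (A i j))) else -P_ 𝔽 (constP 𝔽 (A i j))

  ev-minus : ∀ a → ev (-P_ 𝔽 (constP 𝔽 a)) ≈ᴹ -ᴹ scalar a
  ev-minus a = M.trans (ev-neg (constP 𝔽 a)) (M.-‿cong (ev-const a))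

  ev-charEntry : ∀ i j s t → ev (charEntry i j) s t ≈ idM 𝔽 i j * A s t + - (A i j * idM 𝔽 s t)
  ev-charEntry i j s t with does (i ≟ j)
  ... | true  = trans (ev-+ (varX 𝔽) (-P_ 𝔽 (constP 𝔽 (A i j))) s t)
                      (+-cong (trans (ev-X s t) (sym (*-identityˡ _))) (ev-minus (A i j) s t))
  ... | false = trans (ev-minus (A i j) s t) (sym (trans (+-congʳ (zeroˡ _)) (+-identityˡ _)))

  -- A eⱼ = Σᵢ aᵢⱼ eᵢ, read off as a relation over 𝔽[A] between the basis vectors.
  basis-relation : ∀ j s → sum (λ i → ev (charEntry i j) s i) ≈ 0#
  basis-relation j s = R.begin
    sum (λ i → ev (charEntry i j) s i)
      R.≈⟨ sum-cong-≋ {n} (λ i → ev-charEntry i j s i) ⟩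
    sum (λ i → idM 𝔽 i j * A s i + - (A i j * idM 𝔽 s i))
      R.≈⟨ ∑-distrib-+ (λ i → idM 𝔽 i j * A s i) (λ i → - (A i j * idM 𝔽 s i)) ⟩
    sum (λ i → idM 𝔽 i j * A s i) + sum (λ i → - (A i j * idM 𝔽 s i))
      R.≈⟨ +-cong
           (trans (sum-cong-≋ {n} (λ i → *-congʳ (reflexive (idM-sym i j)))) (sum-idM j (A s)))
           (trans (sum-cong-≋ {n} (λ i → trans (-‿distribˡ-* _ _) (*-comm _ _))) (sum-idM s (λ i → - A i j))) ⟩
    A s j + - A s j
      R.≈⟨ -‿inverseʳ _ ⟩
    0# R.∎
    where module R = SetoidReasoning

  ev-sum : ∀ {m} (f : Fin m → Poly 𝔽) i j → ev (PS.sum f) i j ≈ sum (λ k → ev (f k) i j)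
  ev-sum {zero}  f i j = refl
  ev-sum {suc m} f i j = trans (ev-+ (f zero) _ i j) (+-congˡ (ev-sum (f ∘ suc) i j))

  -- The relations Σᵢ `charEntry i j` eᵢ = 0, one for each j, are multiplied by the cofactors in row
  -- k and added over j. The coefficient of eᵢ becomes χ for i = k and 0 otherwise, so χ(A) eₖ = 0,
  -- which is column k of χ(A).
  cayleyHamilton : Annihilates 𝔽 (charPoly 𝔽 A) A
  cayleyHamilton s k = R.begin
    ev χ s k
      R.≈⟨ sum-idM k (ev χ s) ⟨
    sum (λ i → idM 𝔽 k i * ev χ s i)
      R.≈⟨ sum-cong-≋ {n} (λ i → column i) ⟩
    sum (λ i → ev (PS.sum (λ j → charEntry i j P.* cof j)) s i)
      R.≈⟨ sum-cong-≋ {n} (λ i → trans (ev-sum (λ j → charEntry i j P.* cof j) s i) (sum-cong-≋ {n} (λ j → product i j))) ⟩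
    sum (λ i → sum (λ j → sum (λ t → ev (cof j) s t * ev (charEntry i j) t i)))
      R.≈⟨ ∑-comm (λ i j → sum (λ t → ev (cof j) s t * ev (charEntry i j) t i)) ⟩
    sum (λ j → sum (λ i → sum (λ t → ev (cof j) s t * ev (charEntry i j) t i)))
      R.≈⟨ sum-zero {n} (λ j → trans (∑-comm (λ i t → ev (cof j) s t * ev (charEntry i j) t i)) (sum-zero {n} (λ t → vanish j t))) ⟩
    0# R.∎
    where
    module R = SetoidReasoning
    χ : Poly 𝔽
    χ = charPoly 𝔽 A
    cof : Fin n → Poly 𝔽
    cof = D.cofactor charEntry k
    χ≈det : χ P.≈ D.det n charEntry
    χ≈det = detP≈det n charEntry
    column : ∀ i → idM 𝔽 k i * ev χ s i ≈ ev (PS.sum (λ j → charEntry i j P.* cof j)) s i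
    column i with k ≟ i
    ... | yes ≡.refl = trans (*-identityˡ _) (trans (χ≈det s k) (sym (D.cofactor-same charEntry k s k)))
    ... | no k≢i     = trans (zeroˡ _) (sym (D.cofactor-other charEntry k i k≢i s i))
    product : ∀ i j → ev (charEntry i j P.* cof j) s i ≈ sum (λ t → ev (cof j) s t * ev (charEntry i j) t i)
    -- The factors are exchanged so that `charEntry i j` acts first on eᵢ, where `basis-relation`
    -- can be applied.
    product i j = trans (ev-* (charEntry i j) (cof j) s i)
      (trans (ev-comm (charEntry i j) (cof j) s i) (⊗-sum (ev (cof j)) (ev (charEntry i j)) s i))
    vanish : ∀ j t → sum (λ i → ev (cof j) s t * ev (charEntry i j) t i) ≈ 0#
    vanish j t = trans (sym (*-distribˡ-sum (ev (cof j) s t) (λ i → ev (charEntry i j) t i)))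
      (trans (*-congˡ (basis-relation j t)) (zeroʳ _))

-- The characteristic polynomial is monic of degree n.

module CharacteristicDegree {c ℓ : Level} (𝔽 : FiniteField c ℓ) where
  open FiniteField 𝔽 hiding (zero)
  open Matrices 𝔽 using (ring)
  open import Algebra.Properties.Ring ring
  open import Relation.Binary.Reasoning.Setoid setoid
  private
    module D = Determinant commRing

  coeff-+ : ∀ p q i → coeff 𝔽 (_+P_ 𝔽 p q) i ≈ coeff 𝔽 p i + coeff 𝔽 q i
  coeff-+ []      q       i       = sym (+-identityˡ _)
  coeff-+ (a ∷ p) []      i       = sym (+-identityʳ _)
  coeff-+ (a ∷ p) (b ∷ q) zero    = refl
  coeff-+ (a ∷ p) (b ∷ q) (suc i) = coeff-+ p q i

  coeff-neg : ∀ p i → coeff 𝔽 (-P_ 𝔽 p) i ≈ - coeff 𝔽 p i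
  coeff-neg []      i       = sym -0#≈0#
  coeff-neg (a ∷ p) zero    = refl
  coeff-neg (a ∷ p) (suc i) = coeff-neg p i

  coeff-map : ∀ a p i → coeff 𝔽 (map (a *_) p) i ≈ a * coeff 𝔽 p i
  coeff-map a []      i       = sym (zeroʳ a)
  coeff-map a (b ∷ p) zero    = refl
  coeff-map a (b ∷ p) (suc i) = coeff-map a p i

  -- p has degree at most d, and x is its (possibly zero) coefficient at d.
  Top : Poly 𝔽 → ℕ → Carrier → Set ℓ
  Top p d x = (coeff 𝔽 p d ≈ x) × (∀ i → d ℕ.< i → coeff 𝔽 p i ≈ 0#)

  -- Coefficient lists are not normalised: the tail of a polynomial of degree 0 may be a non-empty
  -- list of zeros, and multiplying by it does not compute to the empty list.
  coeff-*-zeroˡ : ∀ p q → (∀ i → coeff 𝔽 p i ≈ 0#) → ∀ i → coeff 𝔽 (_*P_ 𝔽 p q) i ≈ 0#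
  coeff-*-zeroˡ []      q e i = refl
  coeff-*-zeroˡ (a ∷ p) q e i = begin
    coeff 𝔽 (_*P_ 𝔽 (a ∷ p) q) i
      ≈⟨ coeff-+ (map (a *_) q) _ i ⟩
    coeff 𝔽 (map (a *_) q) i + coeff 𝔽 (0# ∷ _*P_ 𝔽 p q) i
      ≈⟨ +-cong (trans (coeff-map a q i) (trans (*-congʳ (e 0)) (zeroˡ _))) (shift i) ⟩
    0# + 0#
      ≈⟨ +-identityˡ 0# ⟩
    0# ∎
    where
    shift : ∀ i → coeff 𝔽 (0# ∷ _*P_ 𝔽 p q) i ≈ 0#
    shift zero    = refl
    shift (suc i) = coeff-*-zeroˡ p q (e ∘ suc) i

  top-* : ∀ p q {a b x y} → Top p a x → Top q b y → Top (_*P_ 𝔽 p q) (a ℕ.+ b) (x * y)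
  top-* [] q (e , _) _ = trans (sym (zeroˡ _)) (*-congʳ e) , λ _ _ → refl
  top-* (u ∷ p) q {zero} {b} (e , z) (e′ , z′) =
    trans (go b) (*-cong e e′) , λ i b<i → trans (go i) (trans (*-congˡ (z′ i b<i)) (zeroʳ u))
    where
    shift : ∀ i → coeff 𝔽 (0# ∷ _*P_ 𝔽 p q) i ≈ 0#
    shift zero    = refl
    shift (suc i) = coeff-*-zeroˡ p q (λ j → z (suc j) (s≤s z≤n)) i
    go : ∀ i → coeff 𝔽 (_*P_ 𝔽 (u ∷ p) q) i ≈ u * coeff 𝔽 q i
    go i = trans (coeff-+ (map (u *_) q) _ i) (trans (+-cong (coeff-map u q i) (shift i)) (+-identityʳ _))
  top-* (u ∷ p) q {suc a} {b} {x} {y} (e , z) (e′ , z′) =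
    trans (go (a ℕ.+ b) (s≤s (ℕ.m≤n+m b a))) (proj₁ rec) ,
    λ { (suc i) (s≤s a+b<i) → trans (go i (s≤s (ℕ.≤-trans (ℕ.m≤n+m b a) (ℕ.<⇒≤ a+b<i)))) (proj₂ rec i a+b<i) }
    where
    rec : Top (_*P_ 𝔽 p q) (a ℕ.+ b) (x * y)
    rec = top-* p q (e , λ i a<i → z (suc i) (s≤s a<i)) (e′ , z′)
    go : ∀ i → b ℕ.< suc i → coeff 𝔽 (_*P_ 𝔽 (u ∷ p) q) (suc i) ≈ coeff 𝔽 (_*P_ 𝔽 p q) i
    go i b<i = trans (coeff-+ (map (u *_) q) _ (suc i))
      (trans (+-congʳ (trans (coeff-map u q (suc i)) (trans (*-congˡ (z′ (suc i) b<i)) (zeroʳ u)))) (+-identityˡ _))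

  top-+ : ∀ p q {d x y} → Top p d x → Top q d y → Top (_+P_ 𝔽 p q) d (x + y)
  top-+ p q {d} (e , z) (e′ , z′) =
    trans (coeff-+ p q d) (+-cong e e′) ,
    λ i d<i → trans (coeff-+ p q i) (trans (+-cong (z i d<i) (z′ i d<i)) (+-identityˡ 0#))

  top-neg : ∀ p {d x} → Top p d x → Top (-P_ 𝔽 p) d (- x)
  top-neg p {d} (e , z) =
    trans (coeff-neg p d) (-‿cong e) ,
    λ i d<i → trans (coeff-neg p i) (trans (-‿cong (z i d<i)) -0#≈0#)

  top-altSum : ∀ {m d} (f : Fin m → Poly 𝔽) (x : Fin m → Carrier) → (∀ j → Top (f j) d (x j)) →
    Top (altSum 𝔽 f) d (D.alternatingSum x)
  top-altSum {zero}  f x t = reflexive (≡.sym (D.alternatingSum-[] x)) , λ _ _ → refl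
  top-altSum {suc m} {d} f x t = ≡.subst (Top (altSum 𝔽 f) d) (≡.sym (D.alternatingSum-suc x))
    (top-+ (f zero) _ (t zero) (top-neg (altSum 𝔽 (f ∘ suc)) (top-altSum (f ∘ suc) (x ∘ suc) (t ∘ suc))))

  -- Taking the coefficient at the degree bound respects sums and products, hence determinants. In X
  -- - A the coefficients of X form the identity matrix, so the leading coefficient is its
  -- determinant and no expansion over permutations is needed.
  top-detP : ∀ m (N : Fin m → Fin m → Poly 𝔽) (L : Fin m → Fin m → Carrier) →
    (∀ i j → Top (N i j) 1 (L i j)) → Top (detP 𝔽 m N) m (D.det m L)
  top-detP zero    N L t = reflexive (≡.sym (D.det-zero L)) , λ { (suc i) _ → refl }
  top-detP (suc m) N L t = ≡.subst (Top (detP 𝔽 (suc m) N) (suc m)) (≡.sym (D.det-suc L))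
    (top-altSum {d = suc m} (λ j → _*P_ 𝔽 (N zero j) (detP 𝔽 m (λ r s → N (suc r) (punchIn j s)))) _ λ j →
      top-* (N zero j) (detP 𝔽 m (λ r s → N (suc r) (punchIn j s))) (t zero j)
        (top-detP m _ (λ r s → L (suc r) (punchIn j s)) (λ r s → t (suc r) (punchIn j s))))

  det-idM : ∀ m → D.det m (idM 𝔽) ≈ 1#
  det-idM zero    = reflexive (D.det-zero _)
  det-idM (suc m) = begin
    D.det (suc m) (idM 𝔽)   ≈⟨ D.det-lowerTriangular m (idM 𝔽) (λ _ → refl) ⟩
    1# * D.det m (idM 𝔽)    ≈⟨ *-identityˡ _ ⟩
    D.det m (idM 𝔽)         ≈⟨ det-idM m ⟩
    1#                      ∎

  charPoly-monic : ∀ {n} (A : Mat 𝔽 n) → MonicOfDegree 𝔽 (charPoly 𝔽 A) n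
  charPoly-monic {n} A with top-detP n (charEntry A) (idM 𝔽) entry
    where
    open CayleyHamilton 𝔽 using (charEntry)
    constant : ∀ i j → Top (-P_ 𝔽 (constP 𝔽 (A i j))) 1 0#
    constant i j = refl , λ { (suc (suc k)) _ → refl ; (suc zero) (s≤s ()) }
    entry : ∀ i j → Top (charEntry A i j) 1 (idM 𝔽 i j)
    entry i j with does (i ≟ j)
    ... | true  = refl , λ { (suc (suc k)) _ → refl ; (suc zero) (s≤s ()) }
    ... | false = constant i j
  ... | e , z = trans e (det-idM n) , z

-- Newton interpolation basis and the Krylov test for genericity.

module NewtonKrylov {c ℓ : Level} (𝔽 : FiniteField c ℓ) (node : ℕ → FiniteField.Carrier 𝔽) where
  open FiniteField 𝔽 hiding (zero)
  open Matrices 𝔽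
  open import Algebra.Properties.CommutativeSemigroup *-commutativeSemigroup using (x∙yz≈y∙xz)
  open SemiringSum semiring using (sum-permute)
  open import Relation.Binary.Reasoning.Setoid setoid
  private
    module D = Determinant commRing

  applyᴹ : ∀ {n} → Mat 𝔽 n → (Fin n → Carrier) → Fin n → Carrier
  applyᴹ A v i = sum (λ j → A i j * v j)

  applyᴹ-cong : ∀ {n} (A : Mat 𝔽 n) {v w} → (∀ j → v j ≈ w j) → ∀ i → applyᴹ A v i ≈ applyᴹ A w i
  applyᴹ-cong {n} A e i = sum-cong-≋ {n} (λ j → *-congˡ (e j))

  -- (A - c₀) ⋯ (A - cₖ₋₁) 1, where 1 is the all-ones vector.
  newtonVec : ∀ {n} → Mat 𝔽 n → ℕ → Fin n → Carrier
  newtonVec A zero    i = 1#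
  newtonVec A (suc k) i = applyᴹ A (newtonVec A k) i + - (node k * newtonVec A k i)

  -- Coefficients of q in the basis Nₖ = (X - c₀) ⋯ (X - cₖ₋₁), in Horner form: the recursion is
  -- multiplication by X, where X Nₖ = Nₖ₊₁ + cₖ Nₖ.
  newtonCoeff : Poly 𝔽 → ℕ → Carrier
  newtonCoeff []      k       = 0#
  newtonCoeff (a ∷ q) zero    = a + node 0 * newtonCoeff q 0
  newtonCoeff (a ∷ q) (suc k) = newtonCoeff q k + node (suc k) * newtonCoeff q (suc k)

  newtonCoeff-zero : ∀ q k → (∀ i → k ℕ.≤ i → coeff 𝔽 q i ≈ 0#) → newtonCoeff q k ≈ 0#
  newtonCoeff-zero []      k       z = refl
  newtonCoeff-zero (a ∷ q) zero    z =
    trans (+-cong (z 0 z≤n) (trans (*-congˡ (newtonCoeff-zero q 0 (λ i _ → z (suc i) z≤n))) (zeroʳ _))) (+-identityˡ 0#)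
  newtonCoeff-zero (a ∷ q) (suc k) z =
    trans (+-cong (newtonCoeff-zero q k (λ i k≤i → z (suc i) (s≤s k≤i)))
                  (trans (*-congˡ (newtonCoeff-zero q (suc k) (λ i k<i → z (suc i) (s≤s (ℕ.<⇒≤ k<i))))) (zeroʳ _)))
          (+-identityˡ 0#)

  -- Each Nₖ is monic of degree k, so the change of basis from monomials is unitriangular and leaves
  -- the leading coefficient alone.
  newtonCoeff-top : ∀ q e → (∀ i → e ℕ.< i → coeff 𝔽 q i ≈ 0#) → newtonCoeff q e ≈ coeff 𝔽 q e
  newtonCoeff-top []      e       z = refl
  newtonCoeff-top (a ∷ q) zero    z =
    trans (+-congˡ (trans (*-congˡ (newtonCoeff-zero q 0 (λ i _ → z (suc i) (s≤s z≤n)))) (zeroʳ _))) (+-identityʳ a)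
  newtonCoeff-top (a ∷ q) (suc e) z =
    trans (+-cong (newtonCoeff-top q e (λ i e<i → z (suc i) (s≤s e<i)))
                  (trans (*-congˡ (newtonCoeff-zero q (suc e) (λ i e<i → z (suc i) (s≤s e<i)))) (zeroʳ _)))
          (+-identityʳ _)

  coeff-length : ∀ q i → length q ℕ.≤ i → coeff 𝔽 q i ≈ 0#
  coeff-length []      i       _       = refl
  coeff-length (a ∷ q) (suc i) (s≤s l) = coeff-length q i l

  sumTo : ℕ → (ℕ → Carrier) → Carrier
  sumTo m f = sum {m} (f ∘ toℕ)

  sumTo-cong : ∀ m {f g : ℕ → Carrier} → (∀ k → f k ≈ g k) → sumTo m f ≈ sumTo m g
  sumTo-cong m e = sum-cong-≋ {m} (e ∘ toℕ)

  sumTo-extend : ∀ m d f → (∀ k → m ℕ.≤ k → f k ≈ 0#) → sumTo (m ℕ.+ d) f ≈ sumTo m f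
  sumTo-extend zero    d f z = sum-zero {d} (λ i → z (toℕ i) z≤n)
  sumTo-extend (suc m) d f z = +-congˡ (sumTo-extend m d (f ∘ suc) (λ k m≤k → z (suc k) (s≤s m≤k)))

  evalOnes : ∀ {n} → Mat 𝔽 n → Poly 𝔽 → Fin n → Carrier
  evalOnes A q = applyᴹ (evalP 𝔽 q A) (λ _ → 1#)

  evalOnes-∷ : ∀ {n} (A : Mat 𝔽 n) a q i → evalOnes A (a ∷ q) i ≈ a + applyᴹ A (evalOnes A q) i
  evalOnes-∷ {n} A a q i = begin
    sum (λ j → (a * idM 𝔽 i j + (A ⊗ᴹ Q) i j) * 1#)
      ≈⟨ sum-cong-≋ {n} (λ j → trans (distribʳ 1# _ _) (+-cong (trans (*-identityʳ _) (*-comm a _)) (entry j))) ⟩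
    sum (λ j → idM 𝔽 i j * a + sum (λ k → A i k * (Q k j * 1#)))
      ≈⟨ ∑-distrib-+ (λ j → idM 𝔽 i j * a) (λ j → sum (λ k → A i k * (Q k j * 1#))) ⟩
    sum (λ j → idM 𝔽 i j * a) + sum (λ j → sum (λ k → A i k * (Q k j * 1#)))
      ≈⟨ +-cong (sum-idM i (λ _ → a)) (∑-comm (λ j k → A i k * (Q k j * 1#))) ⟩
    a + sum (λ k → sum (λ j → A i k * (Q k j * 1#)))
      ≈⟨ +-congˡ (sum-cong-≋ {n} (λ k → *-distribˡ-sum (A i k) (λ j → Q k j * 1#))) ⟨
    a + applyᴹ A (evalOnes A q) i ∎
    where
    Q : Mat 𝔽 n
    Q = evalP 𝔽 q A
    entry : ∀ j → (A ⊗ᴹ Q) i j * 1# ≈ sum (λ k → A i k * (Q k j * 1#))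
    entry j = trans (*-congʳ (⊗-sum A Q i j)) (trans (*-distribʳ-sum 1# (λ k → A i k * Q k j))
      (sum-cong-≋ {n} (λ k → *-assoc (A i k) (Q k j) 1#)))

  applyᴹ-newtonVec : ∀ {n} (A : Mat 𝔽 n) k i →
    applyᴹ A (newtonVec A k) i ≈ newtonVec A (suc k) i + node k * newtonVec A k i
  applyᴹ-newtonVec A k i = sym (trans (+-assoc _ _ _) (trans (+-congˡ (-‿inverseˡ _)) (+-identityʳ _)))

  -- Horner induction: A sends the k-th Newton vector to the next one plus `node k` times itself,
  -- which is the recursion of `newtonCoeff`. The slack d is needed because a list may end in zeros,
  -- so that `length q` does not compare with n; both sums are later taken over the common range n +
  -- `length q`.
  newton-expansion : ∀ {n} (A : Mat 𝔽 n) q d i →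
    evalOnes A q i ≈ sumTo (length q ℕ.+ d) (λ k → newtonCoeff q k * newtonVec A k i)
  newton-expansion {n} A []      d i = trans (sum-zero {n} (λ j → zeroˡ 1#)) (sym (sum-zero {d} (λ k → zeroˡ _)))
  newton-expansion {n} A (a ∷ q) d i = begin
    evalOnes A (a ∷ q) i
      ≈⟨ evalOnes-∷ A a q i ⟩
    a + applyᴹ A (evalOnes A q) i
      ≈⟨ +-congˡ (applyᴹ-cong A (newton-expansion A q d) i) ⟩
    a + sum (λ j → A i j * sumTo m (λ k → w k * P k j))
      ≈⟨ +-congˡ (sum-cong-≋ {n} (λ j → trans (*-distribˡ-sum {m} (A i j) (λ k → w (toℕ k) * P (toℕ k) j))
           (sumTo-cong m (λ k → x∙yz≈y∙xz (A i j) (w k) (P k j))))) ⟩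
    a + sum (λ j → sumTo m (λ k → w k * (A i j * P k j)))
      ≈⟨ +-congˡ (∑-comm {n} {m} (λ j k → w (toℕ k) * (A i j * P (toℕ k) j))) ⟩
    a + sumTo m (λ k → sum (λ j → w k * (A i j * P k j)))
      ≈⟨ +-congˡ (sumTo-cong m (λ k → *-distribˡ-sum (w k) (λ j → A i j * P k j))) ⟨
    a + sumTo m (λ k → w k * applyᴹ A (P k) i)
      ≈⟨ +-congˡ (sumTo-cong m (λ k → trans (*-congˡ (applyᴹ-newtonVec A k i)) (distribˡ (w k) _ _))) ⟩
    a + sumTo m (λ k → w k * P (suc k) i + g k)
      ≈⟨ +-congˡ (∑-distrib-+ {m} (λ k → w (toℕ k) * P (suc (toℕ k)) i) (g ∘ toℕ)) ⟩
    a + (sumTo m (λ k → w k * P (suc k) i) + sumTo m g)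
      -- `g m` is zero, so the second sum may be given one more term and split at its head `g 0`;
      -- the shifted tail then pairs with the first sum.
      ≈⟨ +-congˡ (+-congˡ last-vanishes) ⟨
    a + (sumTo m (λ k → w k * P (suc k) i) + (g 0 + sumTo m (g ∘ suc)))
      ≈⟨ rearrange a _ (g 0) _ ⟩
    (a + g 0) + (sumTo m (λ k → w k * P (suc k) i) + sumTo m (g ∘ suc))
      ≈⟨ +-congʳ (+-congˡ (trans (*-congʳ (*-comm (node 0) (w 0))) (*-assoc (w 0) (node 0) 1#))) ⟨
    (a + node 0 * w 0 * 1#) + (sumTo m (λ k → w k * P (suc k) i) + sumTo m (g ∘ suc))
      ≈⟨ +-cong (trans (distribʳ 1# a (node 0 * w 0)) (+-congʳ (*-identityʳ a)))
           (trans (sumTo-cong m (λ k → distrib′ k)) (∑-distrib-+ {m} (λ k → w (toℕ k) * P (suc (toℕ k)) i) (g ∘ suc ∘ toℕ))) ⟨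
    sumTo (suc m) (λ k → newtonCoeff (a ∷ q) k * P k i) ∎
    where
    m = length q ℕ.+ d
    w : ℕ → Carrier
    w = newtonCoeff q
    P : ℕ → Fin n → Carrier
    P = newtonVec A
    g : ℕ → Carrier
    g k = w k * (node k * P k i)
    last-vanishes : sumTo (suc m) g ≈ sumTo m g
    last-vanishes = trans (reflexive (≡.cong (λ m → sumTo m g) (ℕ.+-comm 1 m)))
      (sumTo-extend m 1 g (λ k m≤k → trans (*-congʳ (newtonCoeff-zero q k
        (λ j k≤j → coeff-length q j (ℕ.≤-trans (ℕ.m≤m+n (length q) d) (ℕ.≤-trans m≤k k≤j))))) (zeroˡ _)))
    rearrange : ∀ x y z t → x + (y + (z + t)) ≈ (x + z) + (y + t)
    rearrange x y z t = trans (+-congˡ (trans (sym (+-assoc y z t)) (trans (+-congʳ (+-comm y z)) (+-assoc z y t))))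
      (sym (+-assoc x z (y + t)))
    distrib′ : ∀ k → newtonCoeff (a ∷ q) (suc k) * P (suc k) i ≈ w k * P (suc k) i + g (suc k)
    distrib′ k = trans (distribʳ _ _ _) (+-congˡ (trans (*-congʳ (*-comm _ _)) (*-assoc _ _ _)))

  -- Rows run from the longest Newton product to the shortest. In this order the matrix can be made
  -- lower triangular, and then the expansion along the first row has a single term.
  krylov : ∀ {n} → Mat 𝔽 n → Fin n → Fin n → Carrier
  krylov A i = newtonVec A (toℕ (opposite i))

  -- Applying q(A) = 0 to the all-ones vector and expanding in Newton vectors gives a linear
  -- relation between the rows of `krylov A`. If e < n, its coefficient at the e-th Newton vector is
  -- the leading coefficient 1, and `leftKernel` makes the determinant vanish.
  krylov-generic : ∀ {n} (A : Mat 𝔽 n) → ¬ (D.det n (krylov A) ≈ 0#) →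
    ∀ q e → MonicOfDegree 𝔽 q e → Annihilates 𝔽 q A → n ℕ.≤ e
  krylov-generic {n} A det≉0 q e (monic , z) ann = ℕ.≮⇒≥ λ e<n → det≉0 (begin
    D.det n (krylov A)
      ≈⟨ *-identityˡ _ ⟨
    1# * D.det n (krylov A)
      ≈⟨ *-congʳ (sym (trans (reflexive (≡.cong w (index e<n))) (trans (newtonCoeff-top q e z) monic))) ⟩
    -- The e-th Newton vector is the row `opposite e`, whose weight carries a second `opposite`.
    w (toℕ (opposite (opposite (fromℕ< e<n)))) * D.det n (krylov A)
      ≈⟨ D.leftKernel (krylov A) (w ∘ toℕ ∘ opposite) (relation e<n) (opposite (fromℕ< e<n)) ⟩
    0# ∎)
    where
    w : ℕ → Carrier
    w = newtonCoeff q
    index : (e<n : e ℕ.< n) → toℕ (opposite (opposite (fromℕ< e<n))) ≡ e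
    index e<n = ≡.trans (≡.cong toℕ (opposite-involutive (fromℕ< e<n))) (toℕ-fromℕ< e<n)
    relation : e ℕ.< n → ∀ j → sum (λ i → w (toℕ (opposite i)) * krylov A i j) ≈ 0#
    relation e<n j = begin
      sum {n} (λ i → f (toℕ (opposite i)))
        ≈⟨ sum-permute {n} (f ∘ toℕ) Perm.reverse ⟨
      sumTo n f
        ≈⟨ sumTo-extend n (length q) f (λ k n≤k → trans (*-congʳ (newtonCoeff-zero q k
             (λ i k≤i → z i (ℕ.<-≤-trans e<n (ℕ.≤-trans n≤k k≤i))))) (zeroˡ _)) ⟨
      sumTo (n ℕ.+ length q) f
        ≈⟨ reflexive (≡.cong (λ m → sumTo m f) (ℕ.+-comm n (length q))) ⟩
      sumTo (length q ℕ.+ n) f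
        ≈⟨ newton-expansion A q n j ⟨
      evalOnes A q j
        ≈⟨ sum-zero {n} (λ i → trans (*-congʳ (ann j i)) (zeroˡ 1#)) ⟩
      0# ∎
      where
      f : ℕ → Carrier
      f k = w k * newtonVec A k j

  krylov⇒generic : ∀ {n} (A : Mat 𝔽 n) → ¬ (D.det n (krylov A) ≈ 0#) → Generic 𝔽 A
  krylov⇒generic {n} A det≉0 =
    n , CharacteristicDegree.charPoly-monic 𝔽 A , CayleyHamilton.cayleyHamilton 𝔽 A , krylov-generic A det≉0

-- Paths in a digraph.

module _ {n : ℕ} {E : Digraph n} where
  open Path

  Path-trivial : ∀ u → Path E u u 0
  Path-trivial u = record
    { vert = λ _ → u ; start = ≡.refl ; end = ≡.refl ; edges = λ ()
    ; distinct = λ { {zero} {zero} _ → ≡.refl } }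

  Path-tail : ∀ {u v l} (p : Path E u v (suc l)) → Path E (vert p (suc zero)) v l
  Path-tail p = record
    { vert = vert p ∘ suc ; start = ≡.refl ; end = end p ; edges = edges p ∘ suc
    ; distinct = λ e → suc-injective (distinct p e) }

  Path-suffix : ∀ {u v l} (p : Path E u v l) i → PathWithin E (vert p i) v l
  Path-suffix {l = l}     p zero    = l , ℕ.≤-refl , record
    { vert = vert p ; start = ≡.refl ; end = end p ; edges = edges p ; distinct = distinct p }
  Path-suffix {l = suc l} p (suc i) with Path-suffix (Path-tail p) i
  ... | m , m≤l , q = m , ℕ.m≤n⇒m≤1+n m≤l , q

  Path-cons : ∀ {u w v l} → E u w ≡ true → (p : Path E w v l) → (∀ i → vert p i ≢ u) → Path E u v (suc l)
  Path-cons {u} {w} {v} {l} uw p fresh = record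
    { vert = vertices ; start = ≡.refl ; end = end p ; edges = edge ; distinct = λ {i} {j} → inj i j }
    where
    vertices : Fin (suc (suc l)) → Fin n
    vertices zero    = u
    vertices (suc i) = vert p i
    edge : ∀ i → E (vertices (inject₁ i)) (vertices (suc i)) ≡ true
    edge zero    = ≡.trans (≡.cong (E u) (start p)) uw
    edge (suc i) = edges p i
    inj : ∀ i j → vertices i ≡ vertices j → i ≡ j
    inj zero    zero    e = ≡.refl
    inj zero    (suc j) e = contradiction (≡.sym e) (fresh j)
    inj (suc i) zero    e = contradiction e (fresh i)
    inj (suc i) (suc j) e = ≡.cong suc (distinct p e)

  -- If u already lies on the path, prepending it would repeat a vertex; the suffix that starts at u
  -- is then a path from u, no longer than the given one.
  PathWithin-step : ∀ {u w v k} → E u w ≡ true → PathWithin E w v k → PathWithin E u v (suc k)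
  PathWithin-step {u} {w} {v} {k} uw (l , l≤k , p) with Fin.any? (λ i → vert p i ≟ u)
  ... | no fresh = suc l , s≤s l≤k , Path-cons uw p (λ i e → fresh (i , e))
  ... | yes (i , ≡.refl) with Path-suffix p i
  ...   | m , m≤l , q = m , ℕ.≤-trans m≤l (ℕ.m≤n⇒m≤1+n l≤k) , q

  iterate : (Fin n → Fin n) → ℕ → Fin n → Fin n
  iterate f zero    w = w
  iterate f (suc k) w = iterate f k (f w)

  -- Walking along the path and then waiting at its end is an iteration of one map.
  PathWithin⇒iterate : ∀ {u v k} → PathWithin E u v k →
    Σ (Fin n → Fin n) λ f → (∀ w → w ≡ f w ⊎ E w (f w) ≡ true) × iterate f k u ≡ v
  PathWithin⇒iterate {u} {v} {k} (l , l≤k , p) =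
    f , along , ≡.trans (≡.cong (iterate f k) (≡.sym (start p))) (arrive k zero l≤k)
    where
    next : ∀ w → Dec (∃ λ i → vert p (inject₁ i) ≡ w) → Fin n
    next w (yes (i , _)) = vert p (suc i)
    next w (no _)        = w
    onPath? : ∀ w → Dec (∃ λ i → vert p (inject₁ i) ≡ w)
    onPath? w = Fin.any? (λ i → vert p (inject₁ i) ≟ w)
    f : Fin n → Fin n
    f w = next w (onPath? w)
    along : ∀ w → w ≡ f w ⊎ E w (f w) ≡ true
    along w with onPath? w
    ... | yes (i , ≡.refl) = inj₂ (edges p i)
    ... | no _             = inj₁ ≡.refl
    f-inner : ∀ i → f (vert p (inject₁ i)) ≡ vert p (suc i)
    f-inner i with onPath? (vert p (inject₁ i))
    -- The search may name another position of the same vertex; distinctness of the vertices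
    -- identifies the two.
    ... | yes (j , e) = ≡.cong (vert p ∘ suc) (inject₁-injective (distinct p e))
    ... | no off      = contradiction (i , ≡.refl) off
    f-end : f (vert p (fromℕ l)) ≡ vert p (fromℕ l)
    f-end with onPath? (vert p (fromℕ l))
    ... | yes (j , e) = contradiction (≡.sym (distinct p e)) fromℕ≢inject₁
    ... | no _        = ≡.refl
    -- The hypothesis says that m moves are enough to reach the end from position i; moves left over
    -- are spent waiting there.
    arrive : ∀ m i → l ℕ.≤ toℕ i ℕ.+ m → iterate f m (vert p i) ≡ v
    arrive m i far with view i
    arrive zero    .(fromℕ l)   far | ‵fromℕ = end p
    arrive (suc m) .(fromℕ l)   far | ‵fromℕ = ≡.trans (≡.cong (iterate f m) f-end)
      (arrive m (fromℕ l) (ℕ.≤-trans (ℕ.≤-reflexive (≡.sym (toℕ-fromℕ l))) (ℕ.m≤m+n _ m)))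
    arrive zero    .(inject₁ j) far | ‵inject₁ j = contradiction
      (≡.subst (l ℕ.≤_) (≡.trans (ℕ.+-identityʳ _) (toℕ-inject₁ j)) far) (ℕ.<⇒≱ (toℕ<n j))
    arrive (suc m) .(inject₁ j) far | ‵inject₁ j = ≡.trans (≡.cong (iterate f m) (f-inner j))
      (arrive m (suc j) (ℕ.≤-trans far (ℕ.≤-reflexive
        (≡.trans (ℕ.+-suc _ m) (≡.cong (λ t → suc (t ℕ.+ m)) (toℕ-inject₁ j))))))

-- Decidable equality and absence of zero divisors.

module FieldProperties {c ℓ : Level} (𝔽 : FiniteField c ℓ) where
  open FiniteField 𝔽 hiding (zero)
  open Matrices 𝔽
  open import Relation.Binary.Reasoning.Setoid setoid
  private
    module D = Determinant commRing

  index : Carrier → Fin size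
  index x = proj₁ (enum-surj x)

  enum-index : ∀ x → enum (index x) ≈ x
  enum-index x = proj₂ (enum-surj x)

  infix 4 _≈?_
  _≈?_ : ∀ x y → Dec (x ≈ y)
  x ≈? y = map′
    (λ e → trans (sym (enum-index x)) (trans (reflexive (≡.cong enum e)) (enum-index y)))
    (λ e → enum-inj _ _ (trans (enum-index x) (trans e (sym (enum-index y)))))
    (index x ≟ index y)

  *-cancel-zero : ∀ {x y} → ¬ (x ≈ 0#) → x * y ≈ 0# → y ≈ 0#
  *-cancel-zero {x} {y} x≉0 xy≈0 with inverse x x≉0
  ... | z , xz≈1 = begin
    y             ≈⟨ *-identityˡ y ⟨
    1# * y        ≈⟨ *-congʳ xz≈1 ⟨
    x * z * y     ≈⟨ *-congʳ (*-comm x z) ⟩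
    z * x * y     ≈⟨ *-assoc z x y ⟩
    z * (x * y)   ≈⟨ *-congˡ xy≈0 ⟩
    z * 0#        ≈⟨ zeroʳ z ⟩
    0#            ∎

  sum-nonzero : ∀ {n} (f : Fin n → Carrier) → ¬ (sum f ≈ 0#) → ∃ λ i → ¬ (f i ≈ 0#)
  sum-nonzero {zero}  f ≉0 = contradiction refl ≉0
  sum-nonzero {suc n} f ≉0 with f zero ≈? 0#
  ... | no f₀≉0  = zero , f₀≉0
  ... | yes f₀≈0 with sum-nonzero (f ∘ suc) (λ e → ≉0 (trans (+-cong f₀≈0 e) (+-identityˡ 0#)))
  ...   | i , fi≉0 = suc i , fi≉0

  det-lowerTriangular-nonzero : ∀ n (M : Fin n → Fin n → Carrier) →
    (∀ i j → i Fin.< j → M i j ≈ 0#) → (∀ i → ¬ (M i i ≈ 0#)) → ¬ (D.det n M ≈ 0#)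
  det-lowerTriangular-nonzero zero    M lower diag e = 0≉1 (sym (trans (reflexive (≡.sym (D.det-zero M))) e))
  det-lowerTriangular-nonzero (suc n) M lower diag e =
    det-lowerTriangular-nonzero n (λ i j → M (suc i) (suc j)) (λ i j i<j → lower (suc i) (suc j) (s≤s i<j)) (diag ∘ suc)
      (*-cancel-zero (diag zero) (trans (sym (D.det-lowerTriangular n M (λ j → lower zero (suc j) (s≤s z≤n)))) e))

  ^M-cong : ∀ {n} {A B : Mat 𝔽 n} → A ≈ᴹ B → ∀ k → _^M_ 𝔽 A k ≈ᴹ _^M_ 𝔽 B k
  ^M-cong e zero    i j = refl
  ^M-cong {A = A} {B} e (suc k) = ⊗-cong {_} {A} {B} e (^M-cong e k)

-- Powers of the weighted matrix, and samples at which the tests do not vanish.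

module WeightedMatrix {c ℓ : Level} (𝔽 : FiniteField c ℓ) {n : ℕ} (E : Digraph n) where
  open FiniteField 𝔽 hiding (zero)
  open Matrices 𝔽
  open FieldProperties 𝔽
  open import Algebra.Properties.Ring ring
  open import Relation.Binary.Reasoning.Setoid setoid
  private
    module D = Determinant commRing

  weighted-cong : ∀ {x x′ : Mat 𝔽 n} {y y′ : Fin n → Carrier} → x ≈ᴹ x′ → (∀ v → y v ≈ y′ v) →
    weightedMatrix 𝔽 E x y ≈ᴹ weightedMatrix 𝔽 E x′ y′
  weighted-cong ex ey u v with does (u ≟ v) ∨ E u v
  ... | true  = *-cong (ex u v) (ey v)
  ... | false = refl

  weighted-supported : ∀ (x : Mat 𝔽 n) y → (∀ u v → does (u ≟ v) ∨ E u v ≡ false → x u v ≈ 0#) →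
    ∀ u v → weightedMatrix 𝔽 E x y u v ≈ x u v * y v
  weighted-supported x y supported u v with does (u ≟ v) ∨ E u v | supported u v
  ... | true  | _ = refl
  ... | false | z = sym (trans (*-congʳ (z ≡.refl)) (zeroˡ _))

  weighted-nonzero : ∀ (x : Mat 𝔽 n) y u v → ¬ (weightedMatrix 𝔽 E x y u v ≈ 0#) → u ≡ v ⊎ E u v ≡ true
  weighted-nonzero x y u v ≉0 with u ≟ v | E u v
  ... | yes u≡v | _     = inj₁ u≡v
  ... | no  _   | true  = inj₂ ≡.refl
  ... | no  _   | false = contradiction refl ≉0

  -- A non-zero entry of a product has a non-zero summand, which names the next vertex w. A diagonal
  -- entry, w = u, uses up a factor but no edge, which is why the length is only bounded by k.
  power-nonzero⇒path : ∀ (x : Mat 𝔽 n) y k u v → ¬ (_^M_ 𝔽 (weightedMatrix 𝔽 E x y) k u v ≈ 0#) → PathWithin E u v k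
  power-nonzero⇒path x y zero u v ≉0 with u ≟ v
  ... | yes ≡.refl = 0 , z≤n , Path-trivial u
  ... | no _       = contradiction refl ≉0
  power-nonzero⇒path x y (suc k) u v ≉0
    with sum-nonzero (λ w → A u w * _^M_ 𝔽 A k w v) (λ e → ≉0 (trans (⊗-sum A (_^M_ 𝔽 A k) u v) e))
    where A = weightedMatrix 𝔽 E x y
  ... | w , nz with power-nonzero⇒path x y k w v (λ e → nz (trans (*-congˡ e) (zeroʳ _)))
                  | weighted-nonzero x y u w (λ e → nz (trans (*-congʳ e) (zeroˡ _)))
  ...   | l , l≤k , p | inj₁ ≡.refl = l , ℕ.m≤n⇒m≤1+n l≤k , p
  ...   | p           | inj₂ uw     = PathWithin-step uw p

  pathWeights : (Fin n → Fin n) → Mat 𝔽 n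
  pathWeights f u v = idM 𝔽 (f u) v

  off-support : ∀ {u w} → does (u ≟ w) ∨ E u w ≡ false → ¬ (u ≡ w) × ¬ (E u w ≡ true)
  off-support {u} {w} e with u ≟ w
  ... | yes _  = contradiction e λ ()
  ... | no u≢w = u≢w , λ t → contradiction (≡.trans (≡.sym e) t) λ ()

  idM-off : ∀ {u v : Fin n} → ¬ (u ≡ v) → idM 𝔽 u v ≈ 0#
  idM-off {u} {v} u≢v with u ≟ v
  ... | yes u≡v = contradiction u≡v u≢v
  ... | no _    = refl

  idM-on : ∀ (u : Fin n) → idM 𝔽 u u ≈ 1#
  idM-on u with u ≟ u
  ... | yes _  = refl
  ... | no u≢u = contradiction ≡.refl u≢u

  -- Setting every edge weight to 1 could fail, since the number of walks may vanish in positive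
  -- characteristic. Weights that follow a single map f make A the matrix of f, so each row of a
  -- power has exactly one 1, at the iterate of f, and nothing can cancel.
  path⇒power-nonzero : ∀ {u v k} → PathWithin E u v k →
    Σ (Mat 𝔽 n) λ x → ¬ (_^M_ 𝔽 (weightedMatrix 𝔽 E x (λ _ → 1#)) k u v ≈ 0#)
  path⇒power-nonzero {u} {v} {k} p with PathWithin⇒iterate p
  ... | f , along , iter≡v = pathWeights f , λ e →
    0≉1 (sym (trans (sym (idM-on v)) (trans (reflexive (≡.cong (λ w → idM 𝔽 w v) (≡.sym iter≡v))) (trans (sym (power k u v)) e))))
    where
    A : Mat 𝔽 n
    A = weightedMatrix 𝔽 E (pathWeights f) (λ _ → 1#)
    entry : ∀ u w → A u w ≈ idM 𝔽 (f u) w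
    entry u w = trans (weighted-supported (pathWeights f) (λ _ → 1#) supported u w) (*-identityʳ _)
      where
      supported : ∀ u v → does (u ≟ v) ∨ E u v ≡ false → idM 𝔽 (f u) v ≈ 0#
      supported u v off with off-support off | along u
      ... | u≢v , _  | inj₁ u≡fu = idM-off (λ fu≡v → u≢v (≡.trans u≡fu fu≡v))
      ... | _ , noEd | inj₂ uf   = idM-off {f u} {v} (λ fu≡v → noEd (≡.subst (λ w → E u w ≡ true) fu≡v uf))
    power : ∀ k u v → _^M_ 𝔽 A k u v ≈ idM 𝔽 (iterate {E = E} f k u) v
    power zero    u v = refl
    power (suc k) u v = begin
      (A ⊗ᴹ _^M_ 𝔽 A k) u v                             ≈⟨ ⊗-sum A (_^M_ 𝔽 A k) u v ⟩
      sum (λ w → A u w * _^M_ 𝔽 A k w v)                ≈⟨ sum-cong-≋ {n} (λ w → *-cong (entry u w) (power k w v)) ⟩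
      sum (λ w → idM 𝔽 (f u) w * idM 𝔽 (iterate {E = E} f k w) v) ≈⟨ sum-idM (f u) (λ w → idM 𝔽 (iterate {E = E} f k w) v) ⟩
      idM 𝔽 (iterate {E = E} f k (f u)) v               ∎

  -- Diagonal matrix with the interpolation nodes, in reverse order, on the
  -- diagonal: there the Krylov matrix is lower triangular.
  module _ (node : ℕ → Carrier)
           (node-injective : ∀ k l → k ℕ.< n → l ℕ.< n → node k ≈ node l → k ≡ l) where
    open NewtonKrylov 𝔽 node

    krylov-diagonal-nonzero :
      ¬ (D.det n (krylov (weightedMatrix 𝔽 E (idM 𝔽) (λ v → node (toℕ (opposite v))))) ≈ 0#)
    krylov-diagonal-nonzero = det-lowerTriangular-nonzero n (krylov A)
      (λ i j i<j → vanish (toℕ (opposite i)) j (reversed i<j))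
      (λ i → nonzero (toℕ (opposite i)) i ℕ.≤-refl)
      where
      A : Mat 𝔽 n
      A = weightedMatrix 𝔽 E (idM 𝔽) (λ v → node (toℕ (opposite v)))
      d : Fin n → Carrier
      d v = node (toℕ (opposite v))
      entry : ∀ u v → A u v ≈ idM 𝔽 u v * d v
      entry = weighted-supported (idM 𝔽) d (λ u v off → idM-off (proj₁ (off-support off)))
      -- Hence `newtonVec A k j` is the product of the differences `d j` - `node l` over l < k; the
      -- factor l = `toℕ (opposite j)` is the only one that vanishes.
      step : ∀ k i → newtonVec A (suc k) i ≈ (d i + - node k) * newtonVec A k i
      step k i = begin
        applyᴹ A (newtonVec A k) i + - (node k * newtonVec A k i)
          ≈⟨ +-cong (trans (sum-cong-≋ {n} (λ j → trans (*-congʳ (entry i j)) (*-assoc _ _ _)))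
                           (sum-idM i (λ j → d j * newtonVec A k j)))
                    (-‿distribˡ-* (node k) (newtonVec A k i)) ⟩
        d i * newtonVec A k i + - node k * newtonVec A k i
          ≈⟨ distribʳ (newtonVec A k i) (d i) (- node k) ⟨
        (d i + - node k) * newtonVec A k i ∎
      vanish : ∀ k j → toℕ (opposite j) ℕ.< k → newtonVec A k j ≈ 0#
      vanish (suc k) j (s≤s oj≤k) with ℕ.m≤n⇒m<n∨m≡n oj≤k
      ... | inj₁ oj<k   = trans (step k j) (trans (*-congˡ (vanish k j oj<k)) (zeroʳ _))
      ... | inj₂ ≡.refl = trans (step k j) (trans (*-congʳ (-‿inverseʳ _)) (zeroˡ _))
      nonzero : ∀ k j → k ℕ.≤ toℕ (opposite j) → ¬ (newtonVec A k j ≈ 0#)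
      nonzero zero    j k≤oj e = 0≉1 (sym e)
      nonzero (suc k) j k<oj e = nonzero k j (ℕ.<⇒≤ k<oj)
        (*-cancel-zero (λ z → ℕ.<-irrefl (node-injective k (toℕ (opposite j))
            (ℕ.<-trans k<oj (toℕ<n (opposite j))) (toℕ<n (opposite j)) (sym (x-y≈0 z))) k<oj)
          (trans (sym (step k j)) e))
        where
        x-y≈0 : ∀ {x y} → x + - y ≈ 0# → x ≈ y
        x-y≈0 {x} {y} z = trans (sym (trans (+-assoc x (- y) y) (trans (+-congˡ (-‿inverseˡ y)) (+-identityʳ x))))
          (trans (+-congʳ z) (+-identityˡ y))
      reversed : ∀ {i j : Fin n} → i Fin.< j → toℕ (opposite j) ℕ.< toℕ (opposite i)
      reversed {i} {j} i<j = ≡.subst₂ ℕ._<_ (≡.sym (opposite-prop j)) (≡.sym (opposite-prop i))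
        (ℕ.∸-monoʳ-< (s≤s i<j) (toℕ<n j))

-- Polynomial functions of one variable: degrees and roots.

module ℕSum = MonoidSum ℕ.+-0-commutativeMonoid

module PolynomialFunctions {c ℓ : Level} (𝔽 : FiniteField c ℓ) where
  open FiniteField 𝔽 hiding (zero)
  open Matrices 𝔽
  open FieldProperties 𝔽
  open import Algebra.Properties.Ring ring
  open import Algebra.Properties.CommutativeSemigroup +-commutativeSemigroup using (interchange)
  open import Algebra.Properties.CommutativeSemigroup *-commutativeSemigroup using (x∙yz≈y∙xz)
  open import Relation.Binary.Reasoning.Setoid setoid
  private
    module D = Determinant commRing

  -- g is the function of a polynomial of degree at most d, in Horner form.
  DegreeAtMost : ℕ → (Carrier → Carrier) → Set (c ⊔ ℓ)
  DegreeAtMost zero    g = Σ Carrier λ a → ∀ t → g t ≈ a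
  DegreeAtMost (suc d) g = Σ Carrier λ a → Σ (Carrier → Carrier) λ h → DegreeAtMost d h × ∀ t → g t ≈ a + t * h t

  degree-resp : ∀ d {g h} → (∀ t → g t ≈ h t) → DegreeAtMost d h → DegreeAtMost d g
  degree-resp zero    e (a , p)         = a , λ t → trans (e t) (p t)
  degree-resp (suc d) e (a , h , q , p) = a , h , q , λ t → trans (e t) (p t)

  degree-const : ∀ d a → DegreeAtMost d (λ _ → a)
  degree-const zero    a = a , λ _ → refl
  degree-const (suc d) a = a , (λ _ → 0#) , degree-const d 0# ,
    λ t → sym (trans (+-congˡ (zeroʳ t)) (+-identityʳ a))

  degree-suc : ∀ d {g} → DegreeAtMost d g → DegreeAtMost (suc d) g
  degree-suc zero    (a , p)         = degree-resp 1 p (degree-const 1 a)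
  degree-suc (suc d) (a , h , q , p) = a , h , degree-suc d q , p

  degree-+ˡ : ∀ k {d g} → DegreeAtMost d g → DegreeAtMost (k ℕ.+ d) g
  degree-+ˡ zero        p = p
  degree-+ˡ (suc k) {d} p = degree-suc (k ℕ.+ d) (degree-+ˡ k p)

  degree-add : ∀ d {g h} → DegreeAtMost d g → DegreeAtMost d h → DegreeAtMost d (λ t → g t + h t)
  degree-add zero    (a , p) (b , q) = a + b , λ t → +-cong (p t) (q t)
  degree-add (suc d) (a , g , dg , p) (b , h , dh , q) =
    a + b , (λ t → g t + h t) , degree-add d dg dh , λ t → trans (+-cong (p t) (q t))
      (trans (interchange a (t * g t) b (t * h t)) (+-congˡ (sym (distribˡ t (g t) (h t)))))

  degree-scale : ∀ d x {g} → DegreeAtMost d g → DegreeAtMost d (λ t → x * g t)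
  degree-scale zero    x (a , p)         = x * a , λ t → *-congˡ (p t)
  degree-scale (suc d) x (a , h , q , p) = x * a , (λ t → x * h t) , degree-scale d x q ,
    λ t → trans (*-congˡ (p t)) (trans (distribˡ x a (t * h t)) (+-congˡ (x∙yz≈y∙xz x t (h t))))

  degree-neg : ∀ d {g} → DegreeAtMost d g → DegreeAtMost d (λ t → - g t)
  degree-neg d {g} p = degree-resp d (λ t → sym (-1*x≈-x (g t))) (degree-scale d (- 1#) p)

  degree-mul : ∀ d e {g h} → DegreeAtMost d g → DegreeAtMost e h → DegreeAtMost (d ℕ.+ e) (λ t → g t * h t)
  degree-mul zero    e (a , p) q = degree-resp e (λ t → *-congʳ (p t)) (degree-scale e a q)
  degree-mul (suc d) e {h = h} (a , g , dg , p) q =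
    degree-resp (suc (d ℕ.+ e)) (λ t → trans (*-congʳ (p t)) (trans (distribʳ (h t) a (t * g t)) (+-congˡ (*-assoc t (g t) (h t)))))
      (degree-add (suc (d ℕ.+ e)) (degree-+ˡ (suc d) (degree-scale e a q))
        (0# , (λ t → g t * h t) , degree-mul d e dg q , λ t → sym (+-identityˡ _)))

  degree-sum : ∀ d {n} (g : Fin n → Carrier → Carrier) → (∀ i → DegreeAtMost d (g i)) →
    DegreeAtMost d (λ t → sum (λ i → g i t))
  degree-sum d {zero}  g p = degree-const d 0#
  degree-sum d {suc n} g p = degree-add d (p zero) (degree-sum d (g ∘ suc) (p ∘ suc))

  degree-alternatingSum : ∀ d {n} (g : Fin n → Carrier → Carrier) → (∀ i → DegreeAtMost d (g i)) →
    DegreeAtMost d (λ t → D.alternatingSum (λ i → g i t))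
  degree-alternatingSum d {zero}  g p =
    degree-resp d (λ t → reflexive (D.alternatingSum-[] (λ i → g i t))) (degree-const d 0#)
  degree-alternatingSum d {suc n} g p =
    degree-resp d (λ t → reflexive (D.alternatingSum-suc (λ i → g i t)))
      (degree-add d (p zero) (degree-neg d (degree-alternatingSum d (g ∘ suc) (p ∘ suc))))

  -- The bound is kept row by row because the rows of the Krylov matrix have degrees 0, 2, ...,
  -- 2(n-1); bounding each of them by the largest would double the total.
  degree-det : ∀ n (M : Carrier → Fin n → Fin n → Carrier) (δ : Fin n → ℕ) →
    (∀ i j → DegreeAtMost (δ i) (λ t → M t i j)) → DegreeAtMost (ℕSum.sum δ) (λ t → D.det n (M t))
  degree-det zero    M δ p = degree-resp 0 (λ t → reflexive (D.det-zero (M t))) (degree-const 0 1#)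
  degree-det (suc n) M δ p = degree-resp (ℕSum.sum δ) (λ t → reflexive (D.det-suc (M t)))
    (degree-alternatingSum (ℕSum.sum δ) (λ j t → M t zero j * D.det n (λ r s → M t (suc r) (punchIn j s))) λ j →
      degree-mul (δ zero) (ℕSum.sum (δ ∘ suc)) (p zero j)
        (degree-det n (λ t r s → M t (suc r) (punchIn j s)) (δ ∘ suc) (λ r s → p (suc r) (punchIn j s))))

  -- Synthetic division by t - a: for g = b + t h, divide h first, h = h(a) + (t - a) k; then the
  -- quotient of g is h(a) + t k, again in Horner form.
  factor : ∀ d {g} → DegreeAtMost (suc d) g → ∀ a →
    Σ (Carrier → Carrier) λ h → DegreeAtMost d h × ∀ t → g t ≈ g a + (t + - a) * h t
  factor d {g} (b , h , q , p) a = go d q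
    where
    go : ∀ d → DegreeAtMost d h → Σ (Carrier → Carrier) λ k → DegreeAtMost d k × ∀ t → g t ≈ g a + (t + - a) * k t
    combine : ∀ k → (∀ t → h t ≈ h a + (t + - a) * k t) → ∀ t → g t ≈ g a + (t + - a) * (h a + t * k t)
    combine k e t = begin
      g t
        ≈⟨ p t ⟩
      b + t * h t
        ≈⟨ +-congˡ (trans (*-congˡ (e t)) (distribˡ t _ _)) ⟩
      b + (t * h a + t * ((t + - a) * k t))
        ≈⟨ +-congˡ (+-cong (*-congʳ split) (x∙yz≈y∙xz t (t + - a) (k t))) ⟩
      b + ((a + (t + - a)) * h a + (t + - a) * (t * k t))
        ≈⟨ +-congˡ (+-congʳ (distribʳ (h a) a (t + - a))) ⟩
      b + (a * h a + (t + - a) * h a + (t + - a) * (t * k t))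
        ≈⟨ +-congˡ (+-assoc _ _ _) ⟩
      b + (a * h a + ((t + - a) * h a + (t + - a) * (t * k t)))
        ≈⟨ +-assoc _ _ _ ⟨
      b + a * h a + ((t + - a) * h a + (t + - a) * (t * k t))
        ≈⟨ +-cong (sym (p a)) (sym (distribˡ (t + - a) (h a) (t * k t))) ⟩
      g a + (t + - a) * (h a + t * k t) ∎
      where
      split : t ≈ a + (t + - a)
      split = sym (trans (+-comm a _) (trans (+-assoc t (- a) a) (trans (+-congˡ (-‿inverseˡ a)) (+-identityʳ t))))
    go zero    (x , r) = h , (x , r) , λ t → trans
      (combine (λ _ → 0#) (λ s → trans (r s) (trans (sym (r a)) (sym (trans (+-congˡ (zeroʳ _)) (+-identityʳ _))))) t)
      (+-congˡ (*-congˡ (trans (+-congˡ (zeroʳ t)) (trans (+-identityʳ (h a)) (trans (r a) (sym (r t)))))))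
    go (suc d) s with factor d s a
    ... | k , dk , e = (λ t → h a + t * k t) , (h a , k , dk , λ t → refl) , combine k e

  -- Roots are recorded by their indices in the enumeration of the field.
  roots≤degree : ∀ d {g} → DegreeAtMost d g → ∀ {x} → ¬ (g x ≈ 0#) →
    ∀ {ts} → Unique ts → All (λ i → g (enum i) ≈ 0#) ts → length ts ℕ.≤ d
  roots≤degree d       p         gx≉0 [] [] = z≤n
  roots≤degree zero    (a , p) {x} gx≉0 {i ∷ _} (_ ∷ _) (gi≈0 ∷ _) =
    contradiction (trans (p x) (trans (sym (p (enum i))) gi≈0)) gx≉0
  roots≤degree (suc d) {g} p {x} gx≉0 {i ∷ ts} (i∉ts ∷ uniq) (gi≈0 ∷ roots) with factor d p (enum i)
  ... | h , dh , e = s≤s (roots≤degree d dh (λ hx≈0 → gx≉0 (trans (e′ x) (trans (*-congˡ hx≈0) (zeroʳ _)))) uniq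
      (All.zipWith root (i∉ts , roots)))
    where
    e′ : ∀ t → g t ≈ (t + - enum i) * h t
    e′ t = trans (e t) (trans (+-congʳ gi≈0) (+-identityˡ _))
    root : ∀ {j} → i ≢ j × g (enum j) ≈ 0# → h (enum j) ≈ 0#
    root {j} (i≢j , gj≈0) = *-cancel-zero
      (λ z → i≢j (≡.sym (enum-inj j i (+-cancelʳ (- enum i) (enum j) (enum i) (trans z (sym (-‿inverseʳ (enum i))))))))
      (trans (sym (e′ (enum j))) gj≈0)

  module _ {n : ℕ} (M : Carrier → Mat 𝔽 n) (δ : ℕ) (deg : ∀ i j → DegreeAtMost δ (λ t → M t i j)) where

    degree-power : ∀ k i j → DegreeAtMost (k ℕ.* δ) (λ t → _^M_ 𝔽 (M t) k i j)
    degree-power zero    i j = degree-const 0 (idM 𝔽 i j)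
    degree-power (suc k) i j = degree-resp (δ ℕ.+ k ℕ.* δ) (λ t → ⊗-sum (M t) (_^M_ 𝔽 (M t) k) i j)
      (degree-sum (δ ℕ.+ k ℕ.* δ) (λ l t → M t i l * _^M_ 𝔽 (M t) k l j)
        (λ l → degree-mul δ (k ℕ.* δ) (deg i l) (degree-power k l j)))

    module _ (node : ℕ → Carrier) where
      open NewtonKrylov 𝔽 node

      degree-newtonVec : ∀ k i → DegreeAtMost (k ℕ.* δ) (λ t → newtonVec (M t) k i)
      degree-newtonVec zero    i = degree-const 0 1#
      degree-newtonVec (suc k) i = degree-add (δ ℕ.+ k ℕ.* δ)
        (degree-sum (δ ℕ.+ k ℕ.* δ) (λ l t → M t i l * newtonVec (M t) k l)
          (λ l → degree-mul δ (k ℕ.* δ) (deg i l) (degree-newtonVec k l)))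
        (degree-neg (δ ℕ.+ k ℕ.* δ) (degree-+ˡ δ (degree-scale (k ℕ.* δ) (node k) (degree-newtonVec k i))))

      degree-krylov : DegreeAtMost (ℕSum.sum (λ (i : Fin n) → toℕ (opposite i) ℕ.* δ))
                                   (λ t → D.det n (krylov (M t)))
      degree-krylov = degree-det n (λ t → krylov (M t)) (λ i → toℕ (opposite i) ℕ.* δ)
        (λ i j → degree-newtonVec (toℕ (opposite i)) j)

  degree-weighted : ∀ {n} (E : Digraph n) (x : Carrier → Mat 𝔽 n) (y : Carrier → Fin n → Carrier) →
    (∀ u v → DegreeAtMost 1 (λ t → x t u v)) → (∀ v → DegreeAtMost 1 (λ t → y t v)) →
    ∀ u v → DegreeAtMost 2 (λ t → weightedMatrix 𝔽 E (x t) (y t) u v)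
  degree-weighted E x y dx dy u v with does (u ≟ v) ∨ E u v
  ... | true  = degree-mul 1 1 (dx u v) (dy v)
  ... | false = degree-const 2 0#

  degree-line : ∀ a b → DegreeAtMost 1 (λ t → a + t * b)
  degree-line a b = a , (λ _ → b) , (b , λ _ → refl) , λ t → refl

-- Counting over lists, products and vectors.

indicator : Bool → ℕ
indicator true  = 1
indicator false = 0

module _ {a} {A : Set a} where

  tally : List A → (A → ℕ) → ℕ
  tally []       h = 0
  tally (x ∷ xs) h = h x ℕ.+ tally xs h

  tally-cong : ∀ xs {g h : A → ℕ} → (∀ x → g x ≡ h x) → tally xs g ≡ tally xs h
  tally-cong []       e = ≡.refl
  tally-cong (x ∷ xs) e = ≡.cong₂ ℕ._+_ (e x) (tally-cong xs e)

  tally-mono : ∀ xs {g h : A → ℕ} → (∀ x → g x ℕ.≤ h x) → tally xs g ℕ.≤ tally xs h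
  tally-mono []       e = z≤n
  tally-mono (x ∷ xs) e = ℕ.+-mono-≤ (e x) (tally-mono xs e)

  tally-const : ∀ xs c → tally xs (λ _ → c) ≡ length xs ℕ.* c
  tally-const []       c = ≡.refl
  tally-const (x ∷ xs) c = ≡.cong (c ℕ.+_) (tally-const xs c)

  tally-+ : ∀ xs (g h : A → ℕ) → tally xs (λ x → g x ℕ.+ h x) ≡ tally xs g ℕ.+ tally xs h
  tally-+ []       g h = ≡.refl
  tally-+ (x ∷ xs) g h = ≡.trans (≡.cong (g x ℕ.+ h x ℕ.+_) (tally-+ xs g h)) (interchange (g x) (h x) _ _)
    where
    interchange : ∀ p q r s → p ℕ.+ q ℕ.+ (r ℕ.+ s) ≡ p ℕ.+ r ℕ.+ (q ℕ.+ s)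
    interchange = solve-∀

  tally-++ : ∀ xs ys (h : A → ℕ) → tally (xs ++ ys) h ≡ tally xs h ℕ.+ tally ys h
  tally-++ []       ys h = ≡.refl
  tally-++ (x ∷ xs) ys h = ≡.trans (≡.cong (h x ℕ.+_) (tally-++ xs ys h)) (≡.sym (ℕ.+-assoc (h x) _ _))

  length-filter : ∀ {p} {P : A → Set p} (P? : Decidable P) xs →
    length (filter P? xs) ≡ tally xs (λ x → indicator (does (P? x)))
  length-filter P? []       = ≡.refl
  length-filter P? (x ∷ xs) with does (P? x)
  ... | true  = ≡.cong suc (length-filter P? xs)
  ... | false = length-filter P? xs

  -- Expresses that φ permutes the list, as invariance of all sums over it. In this form the
  -- property passes to products of lists by summing one coordinate at a time.
  InvariantUnder : List A → (A → A) → Set a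
  InvariantUnder xs φ = ∀ h → tally xs (h ∘ φ) ≡ tally xs h

module _ {a b} {A : Set a} {B : Set b} where

  tally-map : ∀ (f : A → B) xs h → tally (map f xs) h ≡ tally xs (h ∘ f)
  tally-map f []       h = ≡.refl
  tally-map f (x ∷ xs) h = ≡.cong (h (f x) ℕ.+_) (tally-map f xs h)

  tally-comm : ∀ (xs : List A) (ys : List B) (h : A → B → ℕ) →
    tally xs (λ x → tally ys (h x)) ≡ tally ys (λ y → tally xs (λ x → h x y))
  tally-comm []       ys h = ≡.sym (≡.trans (tally-const ys 0) (ℕ.*-zeroʳ (length ys)))
  tally-comm (x ∷ xs) ys h = ≡.trans (≡.cong (tally ys (h x) ℕ.+_) (tally-comm xs ys h)) (≡.sym (tally-+ ys (h x) _))

tally-product : ∀ {a b c} {A : Set a} {B : Set b} {C : Set c} (f : A → B → C) xs ys h →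
  tally (cartesianProductWith f xs ys) h ≡ tally xs (λ x → tally ys (λ y → h (f x y)))
tally-product f []       ys h = ≡.refl
tally-product f (x ∷ xs) ys h = ≡.trans (tally-++ (map (f x) ys) _ h)
  (≡.cong₂ ℕ._+_ (tally-map (f x) ys h) (tally-product f xs ys h))

length-product : ∀ {a b c} {A : Set a} {B : Set b} {C : Set c} (f : A → B → C) xs ys →
  length (cartesianProductWith f xs ys) ≡ length xs ℕ.* length ys
length-product f []       ys = ≡.refl
length-product f (x ∷ xs) ys = ≡.trans (List.length-++ (map (f x) ys))
  (≡.cong₂ ℕ._+_ (List.length-map (f x) ys) (length-product f xs ys))

tally-tabulate : ∀ {a} {A : Set a} {n} (f : Fin n → A) h → tally (tabulate f) h ≡ ℕSum.sum (h ∘ f)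
tally-tabulate {n = zero}  f h = ≡.refl
tally-tabulate {n = suc n} f h = ≡.cong (h (f zero) ℕ.+_) (tally-tabulate (f ∘ suc) h)

allFin-invariant : ∀ {n} (π : Perm.Permutation′ n) → InvariantUnder (allFin n) (π Perm.⟨$⟩ʳ_)
allFin-invariant π h = ≡.trans (tally-tabulate id (h ∘ (π Perm.⟨$⟩ʳ_)))
  (≡.trans (≡.sym (ℕSum.sum-permute h π)) (≡.sym (tally-tabulate id h)))

-- The origin of q - 1: one index, in the application that of t = 0, is given up, and each of the
-- others contributes at least z.
tally-allBut : ∀ {n} (i : Fin n) h z → (∀ j → j ≢ i → z ℕ.≤ h j) → z ℕ.* (n ∸ 1) ℕ.≤ tally (allFin n) h
tally-allBut {suc n} i h z z≤h = begin
  z ℕ.* n                                   ≤⟨ bound n (λ j → h (punchIn i j)) (λ j → z≤h (punchIn i j) (punchInᵢ≢i i j)) ⟩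
  ℕSum.sum (λ j → h (punchIn i j))          ≤⟨ ℕ.m≤n+m _ (h i) ⟩
  h i ℕ.+ ℕSum.sum (λ j → h (punchIn i j))  ≡⟨ ℕSum.sum-remove {i = i} h ⟨
  ℕSum.sum h                                ≡⟨ tally-tabulate id h ⟨
  tally (allFin (suc n)) h                  ∎
  where
  open ℕ.≤-Reasoning
  bound : ∀ m (g : Fin m → ℕ) → (∀ j → z ℕ.≤ g j) → z ℕ.* m ℕ.≤ ℕSum.sum g
  bound zero    g z≤g = ℕ.≤-reflexive (ℕ.*-zeroʳ z)
  bound (suc m) g z≤g = ℕ.≤-trans (ℕ.≤-reflexive (ℕ.*-suc z m)) (ℕ.+-mono-≤ (z≤g zero) (bound m (g ∘ suc) (z≤g ∘ suc)))

module _ {a} {A : Set a} (xs : List A) where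

  allVecs : ∀ n → List (Vec A n)
  allVecs zero    = [] ∷ []
  allVecs (suc n) = cartesianProductWith _∷_ xs (allVecs n)

  allVecs-unique : Unique xs → ∀ n → Unique (allVecs n)
  allVecs-unique u zero    = [] ∷ []
  allVecs-unique u (suc n) = Unique.cartesianProductWith⁺ _∷_ (λ { ≡.refl → ≡.refl , ≡.refl }) u (allVecs-unique u n)

  allVecs-complete : (∀ x → x ∈ xs) → ∀ {n} (v : Vec A n) → v ∈ allVecs n
  allVecs-complete c []      = here ≡.refl
  allVecs-complete c (x ∷ v) = ∈-cartesianProductWith⁺ _∷_ (c x) (allVecs-complete c v)

  length-allVecs : ∀ n → length (allVecs n) ≡ length xs ℕ.^ n
  length-allVecs zero    = ≡.refl
  length-allVecs (suc n) = ≡.trans (length-product _∷_ xs (allVecs n))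
    (≡.cong (length xs ℕ.*_) (length-allVecs n))

  -- The types of `f` are general so that the lemma can be applied to itself: a row is a vector of
  -- entries and a matrix a vector of rows.
  allVecs-invariant : ∀ {b} {B : Set b} (f : B → A → A) → (∀ b → InvariantUnder xs (f b)) →
    ∀ {n} (p : Vec B n) → InvariantUnder (allVecs n) (zipWith f p)
  allVecs-invariant f inv []      h = ≡.refl
  allVecs-invariant f inv {suc n} (b ∷ p) h = begin
    tally (allVecs (suc n)) (h ∘ zipWith f (b ∷ p))
      ≡⟨ tally-product _∷_ xs (allVecs n) _ ⟩
    tally xs (λ x → tally (allVecs n) (λ v → h (f b x ∷ zipWith f p v)))
      ≡⟨ tally-cong xs (λ x → allVecs-invariant f inv p (λ v → h (f b x ∷ v))) ⟩
    tally xs (λ x → tally (allVecs n) (λ v → h (f b x ∷ v)))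
      ≡⟨ inv b (λ x → tally (allVecs n) (λ v → h (x ∷ v))) ⟩
    tally xs (λ x → tally (allVecs n) (λ v → h (x ∷ v)))
      ≡⟨ tally-product _∷_ xs (allVecs n) h ⟨
    tally (allVecs (suc n)) h ∎
    where open ≡-Reasoning

-- Rare events and their unions.

-- This is Σ 2k over k < m, that is m(m-1). It arises twice: as the sum of the row degrees of the
-- Krylov matrix, and as the sum of the degrees of one entry of Aᵏ over all exponents k < m.
triangle : ℕ → ℕ
triangle zero    = 0
triangle (suc m) = m ℕ.* 2 ℕ.+ triangle m

module RareEvents {a} {A : Set a} (points : List A) (q : ℕ) where

  -- The event P is contained in a decidable event of probability at most d / (q - 1).
  record Rare {p} (d : ℕ) (P : A → Set p) : Set (a ⊔ p) where
    field
      bad    : A → Bool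
      covers : ∀ s → P s → bad s ≡ true
      bound  : tally points (λ s → indicator (bad s)) ℕ.* (q ∸ 1) ℕ.≤ d ℕ.* length points

  open Rare public

  Rare-mono : ∀ {p p′ d} {P : A → Set p} {P′ : A → Set p′} → (∀ s → P′ s → P s) → Rare d P → Rare d P′
  Rare-mono sub r = record { bad = bad r ; covers = λ s → covers r s ∘ sub s ; bound = bound r }

  Rare-none : ∀ {p} {P : A → Set p} d → (∀ s → ¬ P s) → Rare d P
  Rare-none d none = record
    { bad = λ _ → false ; covers = λ s e → contradiction e (none s)
    ; bound = ℕ.≤-trans (ℕ.≤-reflexive (≡.cong (ℕ._* (q ∸ 1)) (≡.trans (tally-const points 0) (ℕ.*-zeroʳ (length points))))) z≤n }

  Rare-⊎ : ∀ {p p′ d d′} {P : A → Set p} {P′ : A → Set p′} → Rare d P → Rare d′ P′ →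
    Rare (d ℕ.+ d′) (λ s → P s ⊎ P′ s)
  Rare-⊎ {d = d} {d′} r r′ = record
    { bad    = λ s → bad r s ∨ bad r′ s
    ; covers = λ { s (inj₁ e) → ≡.cong (_∨ bad r′ s) (covers r s e)
                 ; s (inj₂ e) → ≡.trans (≡.cong (bad r s ∨_) (covers r′ s e)) (Bool.∨-zeroʳ (bad r s)) }
    ; bound  = begin
        tally points (λ s → indicator (bad r s ∨ bad r′ s)) ℕ.* (q ∸ 1)
          ≤⟨ ℕ.*-monoˡ-≤ (q ∸ 1) (tally-mono points (λ s → union (bad r s) (bad r′ s))) ⟩
        tally points (λ s → indicator (bad r s) ℕ.+ indicator (bad r′ s)) ℕ.* (q ∸ 1)
          ≡⟨ ≡.cong (ℕ._* (q ∸ 1)) (tally-+ points _ _) ⟩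
        (tally points (λ s → indicator (bad r s)) ℕ.+ tally points (λ s → indicator (bad r′ s))) ℕ.* (q ∸ 1)
          ≡⟨ ℕ.*-distribʳ-+ (q ∸ 1) (tally points (λ s → indicator (bad r s))) _ ⟩
        _
          ≤⟨ ℕ.+-mono-≤ (bound r) (bound r′) ⟩
        d ℕ.* length points ℕ.+ d′ ℕ.* length points
          ≡⟨ ℕ.*-distribʳ-+ (length points) d d′ ⟨
        (d ℕ.+ d′) ℕ.* length points ∎ }
    where
    open ℕ.≤-Reasoning
    union : ∀ x y → indicator (x ∨ y) ℕ.≤ indicator x ℕ.+ indicator y
    union true  y = s≤s z≤n
    union false y = ℕ.≤-refl

  Rare-∃ : ∀ {p d m} {P : Fin m → A → Set p} → (∀ i → Rare d (P i)) → Rare (m ℕ.* d) (λ s → ∃ λ i → P i s)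
  Rare-∃ {m = zero}  r = Rare-none 0 (λ { s (() , _) })
  Rare-∃ {m = suc m} r = Rare-mono (λ { s (zero , e) → inj₁ e ; s (suc i , e) → inj₂ (i , e) }) (Rare-⊎ (r zero) (Rare-∃ (r ∘ suc)))

  Rare-∃< : ∀ {p} m {P : ℕ → A → Set p} → (∀ k → Rare (k ℕ.* 2) (P k)) →
    Rare (triangle m) (λ s → ∃ λ k → k ℕ.< m × P k s)
  Rare-∃< zero    r = Rare-none 0 (λ { s (_ , () , _) })
  Rare-∃< (suc m) {P} r = Rare-mono split (Rare-⊎ (r m) (Rare-∃< m r))
    where
    split : ∀ s → (∃ λ k → k ℕ.< suc m × P k s) → P m s ⊎ (∃ λ k → k ℕ.< m × P k s)
    split s (k , s≤s k≤m , e) with ℕ.m≤n⇒m<n∨m≡n k≤m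
    ... | inj₁ k<m    = inj₂ (k , k<m , e)
    ... | inj₂ ≡.refl = inj₁ e

  avoiding : ∀ {p d} {P : A → Set p} → Rare d P → List A
  avoiding r = filter (λ s → bad r s Bool.≟ false) points

  avoiding-correct : ∀ {p d} {P : A → Set p} (r : Rare d P) → All (λ s → ¬ P s) (avoiding r)
  avoiding-correct r = All.map (λ good e → contradiction (≡.trans (≡.sym good) (covers r _ e)) (λ ()))
    (all-filter (λ s → bad r s Bool.≟ false) points)

  avoiding-length : ∀ {p d} {P : A → Set p} (r : Rare d P) →
    length (avoiding r) ℕ.+ tally points (λ s → indicator (bad r s)) ≡ length points
  avoiding-length r = begin
    length (avoiding r) ℕ.+ tally points (λ s → indicator (bad r s))
      ≡⟨ ≡.cong (ℕ._+ tally points (λ s → indicator (bad r s))) (length-filter (λ s → bad r s Bool.≟ false) points) ⟩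
    tally points (λ s → indicator (does (bad r s Bool.≟ false))) ℕ.+ tally points (λ s → indicator (bad r s))
      ≡⟨ tally-+ points _ _ ⟨
    tally points (λ s → indicator (does (bad r s Bool.≟ false)) ℕ.+ indicator (bad r s))
      ≡⟨ tally-cong points (λ s → complement (bad r s)) ⟩
    tally points (λ _ → 1)
      ≡⟨ ≡.trans (tally-const points 1) (ℕ.*-identityʳ _) ⟩
    length points ∎
    where
    open ≡-Reasoning
    complement : ∀ x → indicator (does (x Bool.≟ false)) ℕ.+ indicator x ≡ 1
    complement true  = ≡.refl
    complement false = ≡.refl

-- Arithmetic of the final bound.

triangle-closed : ∀ m → triangle m ℕ.+ m ≡ m ℕ.* m
triangle-closed zero    = ≡.refl
triangle-closed (suc m) = begin
  m ℕ.* 2 ℕ.+ triangle m ℕ.+ suc m            ≡⟨ shuffle m (triangle m) ⟩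
  triangle m ℕ.+ m ℕ.+ (m ℕ.+ suc m)          ≡⟨ ≡.cong (ℕ._+ (m ℕ.+ suc m)) (triangle-closed m) ⟩
  m ℕ.* m ℕ.+ (m ℕ.+ suc m)                   ≡⟨ square m ⟩
  suc m ℕ.* suc m                             ∎
  where
  open ≡-Reasoning
  shuffle : ∀ m t → m ℕ.* 2 ℕ.+ t ℕ.+ (1 ℕ.+ m) ≡ t ℕ.+ m ℕ.+ (m ℕ.+ (1 ℕ.+ m))
  shuffle = solve-∀
  square : ∀ m → m ℕ.* m ℕ.+ (m ℕ.+ (1 ℕ.+ m)) ≡ (1 ℕ.+ m) ℕ.* (1 ℕ.+ m)
  square = solve-∀

-- Degree n(n-1) for the Krylov determinant, and n² times Σ_{k<n} 2k for the
-- entries of the powers.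
degree : ℕ → ℕ
degree n = triangle n ℕ.+ n ℕ.* (n ℕ.* triangle n)

-- Adding n + n³ completes each `triangle n` to n², giving n² + n⁴ ≤ n³ + n⁴; the extra n makes the
-- inequality strict. For n = 0 both sides are 0, hence the separate alternative.
degree-bound : ∀ n → degree n ≡ 0 ⊎ degree n ℕ.< n ℕ.^ 4
degree-bound zero    = inj₁ ≡.refl
degree-bound (suc p) = inj₂ (ℕ.+-cancelʳ-< (n ℕ.* (n ℕ.* n)) (degree n) (n ℕ.^ 4) (begin-strict
  degree n ℕ.+ n ℕ.* (n ℕ.* n)
    <⟨ ℕ.+-monoˡ-< (n ℕ.* (n ℕ.* n)) (ℕ.m<m+n (degree n) {n} (s≤s z≤n)) ⟩
  degree n ℕ.+ n ℕ.+ n ℕ.* (n ℕ.* n)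
    ≡⟨ regroup n (triangle n) ⟩
  (triangle n ℕ.+ n) ℕ.+ n ℕ.* (n ℕ.* (triangle n ℕ.+ n))
    ≡⟨ ≡.cong (λ s → s ℕ.+ n ℕ.* (n ℕ.* s)) (triangle-closed n) ⟩
  n ℕ.* n ℕ.+ n ℕ.* (n ℕ.* (n ℕ.* n))
    ≤⟨ ℕ.+-monoˡ-≤ _ (ℕ.m≤n*m (n ℕ.* n) n) ⟩
  n ℕ.* (n ℕ.* n) ℕ.+ n ℕ.* (n ℕ.* (n ℕ.* n))
    ≡⟨ fourth n ⟩
  n ℕ.^ 4 ℕ.+ n ℕ.* (n ℕ.* n) ∎))
  where
  open ℕ.≤-Reasoning
  n = suc p
  regroup : ∀ n t → t ℕ.+ n ℕ.* (n ℕ.* t) ℕ.+ n ℕ.+ n ℕ.* (n ℕ.* n) ≡ t ℕ.+ n ℕ.+ n ℕ.* (n ℕ.* (t ℕ.+ n))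
  regroup = solve-∀
  fourth : ∀ n → n ℕ.* (n ℕ.* n) ℕ.+ n ℕ.* (n ℕ.* (n ℕ.* n)) ≡ n ℕ.* (n ℕ.* (n ℕ.* (n ℕ.* 1))) ℕ.+ n ℕ.* (n ℕ.* n)
  fourth = solve-∀

unionBound : ∀ {d f q good failed total} → d ≡ 0 ⊎ d ℕ.< f → f ℕ.< q → 2 ℕ.≤ q → good ℕ.+ failed ≡ total →
  failed ℕ.* (q ∸ 1) ℕ.≤ d ℕ.* total → q ℕ.* total ℕ.≤ good ℕ.* q ℕ.+ f ℕ.* total
unionBound {d} {f} {suc (suc p)} {good} {failed} {total} d<f (s≤s f≤r) (s≤s (s≤s _)) split few = begin
  q ℕ.* total                        ≡⟨ ≡.cong (q ℕ.*_) split ⟨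
  q ℕ.* (good ℕ.+ failed)            ≡⟨ ℕ.*-distribˡ-+ q good failed ⟩
  q ℕ.* good ℕ.+ q ℕ.* failed        ≡⟨ ≡.cong₂ ℕ._+_ (ℕ.*-comm q good) (ℕ.*-comm q failed) ⟩
  good ℕ.* q ℕ.+ failed ℕ.* q        ≤⟨ ℕ.+-monoʳ-≤ (good ℕ.* q) (ℕ.*-cancelʳ-≤ (failed ℕ.* q) (f ℕ.* total) r scaled) ⟩
  good ℕ.* q ℕ.+ f ℕ.* total         ∎
  where
  open ℕ.≤-Reasoning
  r = suc p
  q = suc r
  -- The exchange of q - 1 for q. With d + 1 ≤ f ≤ q - 1 = r one has d q = d r + d ≤ (d + 1) r ≤ f
  -- r: strictness of d < f pays for the extra d.
  degrees : d ≡ 0 ⊎ d ℕ.< f → d ℕ.* q ℕ.≤ f ℕ.* r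
  degrees (inj₁ ≡.refl) = z≤n
  degrees (inj₂ d<f)    = begin
    d ℕ.* q        ≡⟨ ℕ.*-suc d r ⟩
    d ℕ.+ d ℕ.* r  ≤⟨ ℕ.+-monoˡ-≤ (d ℕ.* r) (ℕ.≤-trans (ℕ.<⇒≤ d<f) f≤r) ⟩
    suc d ℕ.* r    ≤⟨ ℕ.*-monoˡ-≤ r d<f ⟩
    f ℕ.* r        ∎
  swap : ∀ x y z → x ℕ.* y ℕ.* z ≡ x ℕ.* z ℕ.* y
  swap = solve-∀
  scaled : failed ℕ.* q ℕ.* r ℕ.≤ f ℕ.* total ℕ.* r
  scaled = begin
    failed ℕ.* q ℕ.* r  ≡⟨ swap failed q r ⟩
    failed ℕ.* r ℕ.* q  ≤⟨ ℕ.*-monoˡ-≤ q few ⟩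
    d ℕ.* total ℕ.* q   ≡⟨ swap d total q ⟩
    d ℕ.* q ℕ.* total   ≤⟨ ℕ.*-monoˡ-≤ total (degrees d<f) ⟩
    f ℕ.* r ℕ.* total   ≡⟨ swap f r total ⟩
    f ℕ.* total ℕ.* r   ∎

-- The sample space, lines through a sample, and the failure events.

module RandomMatrix {c ℓ : Level} (𝔽 : FiniteField c ℓ) {n : ℕ} (E : Digraph n) where
  open FiniteField 𝔽 hiding (zero)
  open Matrices 𝔽
  open FieldProperties 𝔽
  open WeightedMatrix 𝔽 E
  open PolynomialFunctions 𝔽
  private
    module D = Determinant commRing

  indices : List (Fin size)
  indices = allFin size

  samples : List (Sample 𝔽 n)
  samples = cartesianProduct (allVecs (allVecs indices n) n) (allVecs indices n)

  samples-unique : Unique samples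
  samples-unique = Unique.cartesianProduct⁺ (allVecs-unique _ (allVecs-unique _ (Unique.allFin⁺ size) n) n)
                                            (allVecs-unique _ (Unique.allFin⁺ size) n)

  samples-complete : ∀ s → s ∈ samples
  samples-complete (P , y) = ∈-cartesianProduct⁺ (allVecs-complete _ (allVecs-complete _ ∈-allFin) P)
                                                 (allVecs-complete _ ∈-allFin y)

  length-samples : length samples ≡ size ℕ.^ (n ℕ.* n ℕ.+ n)
  length-samples = begin
    length samples
      ≡⟨ length-product _,_ (allVecs (allVecs indices n) n) (allVecs indices n) ⟩
    length (allVecs (allVecs indices n) n) ℕ.* length (allVecs indices n)
      ≡⟨ ≡.cong₂ ℕ._*_ (≡.trans (length-allVecs (allVecs indices n) n) (≡.cong (ℕ._^ n) row)) row ⟩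
    (size ℕ.^ n) ℕ.^ n ℕ.* size ℕ.^ n
      ≡⟨ ≡.cong (ℕ._* size ℕ.^ n) (ℕ.^-*-assoc size n n) ⟩
    size ℕ.^ (n ℕ.* n) ℕ.* size ℕ.^ n
      ≡⟨ ℕ.^-distribˡ-+-* size (n ℕ.* n) n ⟨
    size ℕ.^ (n ℕ.* n ℕ.+ n) ∎
    where
    open ≡-Reasoning
    row : length (allVecs indices n) ≡ size ℕ.^ n
    row = ≡.trans (length-allVecs indices n) (≡.cong (ℕ._^ n) (List.length-tabulate id))

  open RareEvents samples size

  index-unique : ∀ {x i} → x ≈ enum i → index x ≡ i
  index-unique {x} e = enum-inj _ _ (trans (enum-index x) e)

  move : Carrier → Fin size → Fin size → Fin size
  move t b i = index (enum b + t * enum i)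

  moveSample : Carrier → Sample 𝔽 n → Sample 𝔽 n → Sample 𝔽 n
  moveSample t (P , y) (W , z) = zipWith (zipWith (move t)) P W , zipWith (move t) y z

  move-invariant : ∀ t → ¬ (t ≈ 0#) → ∀ b → InvariantUnder indices (move t b)
  move-invariant t t≉0 b = allFin-invariant (Perm.permutation (move t b) back forth-back back-forth)
    where
    open import Relation.Binary.Reasoning.Setoid setoid
    t⁻¹ : Carrier
    t⁻¹ = proj₁ (inverse t t≉0)
    tt⁻¹ : t * t⁻¹ ≈ 1#
    tt⁻¹ = proj₂ (inverse t t≉0)
    back : Fin size → Fin size
    back j = index (t⁻¹ * (- enum b + enum j))
    forth-back : ∀ j → move t b (back j) ≡ j
    forth-back j = index-unique (begin
      enum b + t * enum (back j)                ≈⟨ +-congˡ (*-congˡ (enum-index _)) ⟩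
      enum b + t * (t⁻¹ * (- enum b + enum j))  ≈⟨ +-congˡ (trans (sym (*-assoc _ _ _)) (trans (*-congʳ tt⁻¹) (*-identityˡ _))) ⟩
      enum b + (- enum b + enum j)              ≈⟨ trans (sym (+-assoc _ _ _)) (trans (+-congʳ (-‿inverseʳ _)) (+-identityˡ _)) ⟩
      enum j                                    ∎)
    back-forth : ∀ i → back (move t b i) ≡ i
    back-forth i = index-unique (begin
      t⁻¹ * (- enum b + enum (move t b i))        ≈⟨ *-congˡ (+-congˡ (enum-index _)) ⟩
      t⁻¹ * (- enum b + (enum b + t * enum i))    ≈⟨ *-congˡ (trans (sym (+-assoc _ _ _)) (trans (+-congʳ (-‿inverseˡ _)) (+-identityˡ _))) ⟩
      t⁻¹ * (t * enum i)                          ≈⟨ trans (sym (*-assoc _ _ _)) (trans (*-congʳ (trans (*-comm _ _) tt⁻¹)) (*-identityˡ _)) ⟩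
      enum i                                      ∎)

  moveSample-invariant : ∀ t → ¬ (t ≈ 0#) → ∀ p → InvariantUnder samples (moveSample t p)
  moveSample-invariant t t≉0 (P , y) h = begin
    tally samples (h ∘ moveSample t (P , y))
      ≡⟨ tally-product _,_ matrices vectors (h ∘ moveSample t (P , y)) ⟩
    tally matrices (λ W → tally vectors (λ z → h (zipWith (zipWith (move t)) P W , zipWith (move t) y z)))
      ≡⟨ tally-cong matrices (λ W → allVecs-invariant indices (move t) (move-invariant t t≉0) y
           (λ z → h (zipWith (zipWith (move t)) P W , z))) ⟩
    tally matrices (λ W → tally vectors (λ z → h (zipWith (zipWith (move t)) P W , z)))
      ≡⟨ allVecs-invariant vectors (zipWith (move t)) (allVecs-invariant indices (move t) (move-invariant t t≉0)) P
           (λ W → tally vectors (λ z → h (W , z))) ⟩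
    tally matrices (λ W → tally vectors (λ z → h (W , z)))
      ≡⟨ tally-product _,_ matrices vectors h ⟨
    tally samples h ∎
    where
    open ≡-Reasoning
    vectors : List (Vec (Fin size) n)
    vectors = allVecs indices n
    matrices : List (Vec (Vec (Fin size) n) n)
    matrices = allVecs vectors n

  -- The line of `moveSample` with field elements in place of indices: the entries are then visibly
  -- polynomial in t, whereas the samples themselves are only codes for field elements.
  lineMatrix : Sample 𝔽 n → Sample 𝔽 n → Carrier → Mat 𝔽 n
  lineMatrix (P , y) (W , z) t = weightedMatrix 𝔽 E
    (λ u v → enum (lookup (lookup P u) v) + t * enum (lookup (lookup W u) v))
    (λ v → enum (lookup y v) + t * enum (lookup z v))

  matrixOf-moveSample : ∀ t p w → matrixOf 𝔽 E (moveSample t p w) ≈ᴹ lineMatrix p w t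
  matrixOf-moveSample t (P , y) (W , z) = weighted-cong
    (λ u v → trans (reflexive (≡.cong enum (≡.trans
        (≡.cong (λ r → lookup r v) (Vec.lookup-zipWith (zipWith (move t)) u P W))
        (Vec.lookup-zipWith (move t) v (lookup P u) (lookup W u)))))
      (enum-index _))
    (λ v → trans (reflexive (≡.cong enum (Vec.lookup-zipWith (move t) v y z))) (enum-index _))

  lineMatrix-0 : ∀ p w → lineMatrix p w 0# ≈ᴹ matrixOf 𝔽 E p
  lineMatrix-0 (P , y) (W , z) = weighted-cong (λ u v → collapse _ _) (λ v → collapse _ _)
    where
    collapse : ∀ a b → a + 0# * b ≈ a
    collapse a b = trans (+-congˡ (zeroˡ b)) (+-identityʳ a)

  lineMatrix-degree : ∀ p w u v → DegreeAtMost 2 (λ t → lineMatrix p w t u v)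
  lineMatrix-degree (P , y) (W , z) = degree-weighted E _ _
    (λ u v → degree-line (enum (lookup (lookup P u) v)) (enum (lookup (lookup W u) v)))
    (λ v → degree-line (enum (lookup y v)) (enum (lookup z v)))

  sampleOf : Mat 𝔽 n → (Fin n → Carrier) → Sample 𝔽 n
  sampleOf x y = Vec.tabulate (λ u → Vec.tabulate (λ v → index (x u v))) , Vec.tabulate (index ∘ y)

  matrixOf-sampleOf : ∀ x y → matrixOf 𝔽 E (sampleOf x y) ≈ᴹ weightedMatrix 𝔽 E x y
  matrixOf-sampleOf x y = weighted-cong
    (λ u v → trans (reflexive (≡.cong enum (≡.trans
        (≡.cong (λ r → lookup r v) (Vec.lookup∘tabulate (λ u → Vec.tabulate (λ v → index (x u v))) u))
        (Vec.lookup∘tabulate (λ v → index (x u v)) v))))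
      (enum-index _))
    (λ v → trans (reflexive (≡.cong enum (Vec.lookup∘tabulate (index ∘ y) v))) (enum-index _))

  -- Count pairs (t , w) with the test vanishing at p + t w, where p is a
  -- non-root: there are at most d of them for each w, while for each t ≠ 0 the
  -- map w ↦ p + t w permutes the samples.
  Rare-root : (G : Mat 𝔽 n → Carrier) → (∀ {A B} → A ≈ᴹ B → G A ≈ G B) → ∀ d →
    (∀ M → (∀ u v → DegreeAtMost 2 (λ t → M t u v)) → DegreeAtMost d (λ t → G (M t))) →
    ∀ p → ¬ (G (matrixOf 𝔽 E p) ≈ 0#) → Rare d (λ s → G (matrixOf 𝔽 E s) ≈ 0#)
  Rare-root G G-cong d G-degree p Gp≉0 = record
    { bad    = does ∘ root?
    ; covers = λ s → dec-true (root? s)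
    ; bound  = begin
        tally samples χ ℕ.* (size ∸ 1)
          ≤⟨ tally-allBut (index 0#) _ _ (λ i i≢0 → ℕ.≤-reflexive (≡.sym
               (moveSample-invariant (enum i) (λ e → i≢0 (≡.sym (index-unique (sym e)))) p χ))) ⟩
        tally indices (λ i → tally samples (λ w → χ (moveSample (enum i) p w)))
          ≡⟨ tally-comm indices samples (λ i w → χ (moveSample (enum i) p w)) ⟩
        tally samples (λ w → tally indices (λ i → χ (moveSample (enum i) p w)))
          ≤⟨ tally-mono samples line ⟩
        tally samples (λ _ → d)
          ≡⟨ ≡.trans (tally-const samples d) (ℕ.*-comm _ d) ⟩
        d ℕ.* length samples ∎ }
    where
    open ℕ.≤-Reasoning
    root? : ∀ s → Dec (G (matrixOf 𝔽 E s) ≈ 0#)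
    root? s = G (matrixOf 𝔽 E s) ≈? 0#
    χ : Sample 𝔽 n → ℕ
    χ s = indicator (does (root? s))
    line : ∀ w → tally indices (λ i → χ (moveSample (enum i) p w)) ℕ.≤ d
    line w = ℕ.≤-trans (ℕ.≤-reflexive (≡.sym (length-filter onLine? indices)))
      (roots≤degree d (G-degree (lineMatrix p w) (lineMatrix-degree p w))
        -- At t = 0 every line passes through p, so 0 is a non-root whatever the direction w.
        {0#} (λ e → Gp≉0 (trans (sym (G-cong (lineMatrix-0 p w))) e))
        (Unique.filter⁺ onLine? (Unique.allFin⁺ size))
        (All.map (λ {i} e → trans (sym (G-cong (matrixOf-moveSample (enum i) p w))) e) (all-filter onLine? indices)))
      where
      onLine? : ∀ i → Dec (G (matrixOf 𝔽 E (moveSample (enum i) p w)) ≈ 0#)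
      onLine? i = root? (moveSample (enum i) p w)

  -- Existence of a path is not decided. The finite list of samples is searched for one with a
  -- non-zero entry: if there is one, it serves as the base point of the lines; if there is none, no
  -- path exists, as a path would provide such a sample, and the event is empty.
  Rare-missingPath : ∀ u v k →
    Rare (k ℕ.* 2) (λ s → PathWithin E u v k × _^M_ 𝔽 (matrixOf 𝔽 E s) k u v ≈ 0#)
  Rare-missingPath u v k with any? (λ s → ¬? (_^M_ 𝔽 (matrixOf 𝔽 E s) k u v ≈? 0#)) samples
  ... | yes found = Rare-mono (λ s → proj₂)
    (Rare-root (λ A → _^M_ 𝔽 A k u v) (λ {A} {B} e → ^M-cong {n} {A} {B} e k u v) (k ℕ.* 2)
      (λ M deg → degree-power M 2 deg k u v) (proj₁ (find found)) (proj₂ (proj₂ (find found))))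
  ... | no none = Rare-none (k ℕ.* 2) λ { _ (path , _) →
    let x , ≉0 = path⇒power-nonzero path
    in none (lose (samples-complete (sampleOf x (λ _ → 1#)))
         (λ e → ≉0 (trans (sym (^M-cong {n} {matrixOf 𝔽 E (sampleOf x (λ _ → 1#))} {weightedMatrix 𝔽 E x (λ _ → 1#)} (matrixOf-sampleOf x (λ _ → 1#)) k u v)) e))) }

  module _ (n≤size : n ℕ.≤ size) where

    node : ℕ → Carrier
    node k with k ℕ.<? size
    ... | yes k<q = enum (fromℕ< k<q)
    -- An arbitrary value: distinctness of the nodes is only used at indices below n ≤ `size`, and
    -- the Newton expansion holds for any nodes.
    ... | no  _   = 0#

    node-injective : ∀ k l → k ℕ.< n → l ℕ.< n → node k ≈ node l → k ≡ l
    node-injective k l k<n l<n e with k ℕ.<? size | l ℕ.<? size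
    ... | yes k<q | yes l<q = fromℕ<-injective k l k<q l<q (enum-inj _ _ e)
    ... | yes _   | no l≮q  = contradiction (ℕ.<-≤-trans l<n n≤size) l≮q
    ... | no k≮q  | _       = contradiction (ℕ.<-≤-trans k<n n≤size) k≮q

    open NewtonKrylov 𝔽 node

    newtonVec-cong : ∀ {A B : Mat 𝔽 n} → A ≈ᴹ B → ∀ k i → newtonVec A k i ≈ newtonVec B k i
    newtonVec-cong e zero    i = refl
    newtonVec-cong e (suc k) i = +-cong
      (sum-cong-≋ {n} (λ j → *-cong (e i j) (newtonVec-cong e k j)))
      (-‿cong (*-congˡ (newtonVec-cong e k i)))

    sum-opposite : ∀ m → ℕSum.sum (λ (i : Fin m) → toℕ (opposite i) ℕ.* 2) ≡ triangle m
    sum-opposite zero    = ≡.refl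
    sum-opposite (suc m) = ≡.cong₂ ℕ._+_ (≡.cong (ℕ._* 2) (toℕ-fromℕ m))
      (≡.trans (ℕSum.sum-cong-≗ {m} (λ i → ≡.cong (ℕ._* 2) (toℕ-inject₁ (opposite i)))) (sum-opposite m))

    Rare-nongeneric : Rare (triangle n) (λ s → D.det n (krylov (matrixOf 𝔽 E s)) ≈ 0#)
    Rare-nongeneric = Rare-root (λ A → D.det n (krylov A))
      (λ e → D.det-cong n (λ i j → newtonVec-cong e (toℕ (opposite i)) j)) (triangle n)
      (λ M deg → ≡.subst (λ d → DegreeAtMost d (λ t → D.det n (krylov (M t)))) (sum-opposite n) (degree-krylov M 2 deg node))
      (sampleOf (idM 𝔽) diagonal)
      (λ e → krylov-diagonal-nonzero node node-injective (trans
        (D.det-cong n (λ i j → newtonVec-cong (λ u v → sym (matrixOf-sampleOf (idM 𝔽) diagonal u v)) (toℕ (opposite i)) j)) e))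
      where
      diagonal : Fin n → Carrier
      diagonal v = node (toℕ (opposite v))

    Failure : Sample 𝔽 n → Set ℓ
    Failure s = D.det n (krylov (matrixOf 𝔽 E s)) ≈ 0# ⊎
      (∃ λ u → ∃ λ v → ∃ λ k → k ℕ.< n × PathWithin E u v k × _^M_ 𝔽 (matrixOf 𝔽 E s) k u v ≈ 0#)

    Rare-failure : Rare (degree n) Failure
    Rare-failure = Rare-⊎ Rare-nongeneric (Rare-∃ λ u → Rare-∃ λ v → Rare-∃< n (Rare-missingPath u v))

    nonfailure⇒good : ∀ s → ¬ Failure s → GoodMatrix 𝔽 E (matrixOf 𝔽 E s)
    nonfailure⇒good (P , y) ok = krylov⇒generic _ (ok ∘ inj₁) , λ u v k 1≤k k≤n-1 →
      power-nonzero⇒path _ _ k u v ,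
      λ path e → ok (inj₂ (u , v , k , ℕ.≤-<-trans k≤n-1 (pred< u) , path , e))
      where
      -- The vertex u witnesses that there is at least one vertex; for n = 0 truncated subtraction
      -- would make the inequality false.
      pred< : ∀ {m} → Fin m → m ∸ 1 ℕ.< m
      pred< {suc m} _ = ℕ.n<1+n m

  2≤size : 2 ℕ.≤ size
  2≤size = go size (index 0#) (index 1#) λ e →
    0≉1 (trans (sym (enum-index 0#)) (trans (reflexive (≡.cong enum e)) (enum-index 1#)))
    where
    go : ∀ m (i j : Fin m) → i ≢ j → 2 ℕ.≤ m
    go (suc zero)    zero zero i≢j = contradiction ≡.refl i≢j
    go (suc (suc m)) _    _    _   = s≤s (s≤s z≤n)

-- Assembling the probability bound.

theorem10 : {c ℓ : Level} (𝔽 : FiniteField c ℓ) (n : ℕ) (E : Digraph n) →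
    ProbabilityAtLeast1-n⁴/q 𝔽 (λ s → GoodMatrix 𝔽 E (matrixOf 𝔽 E s))
theorem10 𝔽 n E with n ℕ.^ 4 ℕ.<? FiniteField.size 𝔽
-- Here q ≤ n⁴, so the term n⁴ qᴺ alone reaches qᴺ⁺¹ and the empty list of good samples suffices.
... | no n⁴≮q = [] , [] , [] , (begin
  q ℕ.^ (N ℕ.+ 1)            ≡⟨ ℕ.^-distribˡ-+-* q N 1 ⟩
  q ℕ.^ N ℕ.* (q ℕ.* 1)      ≡⟨ ≡.cong (q ℕ.^ N ℕ.*_) (ℕ.*-identityʳ q) ⟩
  q ℕ.^ N ℕ.* q              ≤⟨ ℕ.*-monoʳ-≤ (q ℕ.^ N) (ℕ.≮⇒≥ n⁴≮q) ⟩
  q ℕ.^ N ℕ.* n ℕ.^ 4        ≡⟨ ℕ.*-comm (q ℕ.^ N) (n ℕ.^ 4) ⟩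
  n ℕ.^ 4 ℕ.* q ℕ.^ N        ∎)
  where
  open ℕ.≤-Reasoning
  q = FiniteField.size 𝔽
  N = n ℕ.* n ℕ.+ n
... | yes n⁴<q = avoiding failure , Unique.filter⁺ _ samples-unique ,
  All.map (λ {s} → nonfailure⇒good n≤q s) (avoiding-correct failure) , (begin
  q ℕ.^ (N ℕ.+ 1)
    ≡⟨ ≡.trans (ℕ.^-distribˡ-+-* q N 1) (≡.trans (ℕ.*-comm (q ℕ.^ N) (q ℕ.* 1)) (≡.cong (ℕ._* q ℕ.^ N) (ℕ.*-identityʳ q))) ⟩
  q ℕ.* q ℕ.^ N
    ≤⟨ unionBound {degree n} {n ℕ.^ 4} {q} {length (avoiding failure)} {tally samples (indicator ∘ bad failure)}
         (degree-bound n) n⁴<q 2≤size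
         (≡.trans (avoiding-length failure) length-samples)
         (ℕ.≤-trans (bound failure) (ℕ.≤-reflexive (≡.cong (degree n ℕ.*_) length-samples))) ⟩
  length (avoiding failure) ℕ.* q ℕ.+ n ℕ.^ 4 ℕ.* q ℕ.^ N ∎)
  where
  open ℕ.≤-Reasoning
  open RandomMatrix 𝔽 E
  q = FiniteField.size 𝔽
  N = n ℕ.* n ℕ.+ n
  open RareEvents samples q
  m≤m⁴ : ∀ m → m ℕ.≤ m ℕ.^ 4
  m≤m⁴ zero    = z≤n
  m≤m⁴ (suc m) = ℕ.m≤m*n (suc m) (suc m ℕ.^ 3) {{ℕ.m^n≢0 (suc m) 3}}
  -- Provides the n distinct interpolation nodes.
  n≤q : n ℕ.≤ q
  n≤q = ℕ.≤-trans (m≤m⁴ n) (ℕ.<⇒≤ n⁴<q)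
  failure : Rare (degree n) (Failure n≤q)
  failure = Rare-failure n≤q
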